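{- We have $\psi_{FV}=\psi_{YZL}\circ\Psi$ as maps from $\mathfrak{S}_{n+1}$ to $\mathcal{LH}_n$.
   Context: A 2-Motzkin path of length $n$ is a word $\mathbf{s}=s_1\ldots s_n$ on the alphabet $\{\textsc{U},\textsc{D},\textsc{L}_r,\textsc{L}_b\}$ with as many letters $\textsc{U}$ as $\textsc{D}$ and heights $h_i(\mathbf{s})=|s_1\ldots s_i|_{\textsc{U}}-|s_1\ldots s_i|_{\textsc{D}}\ge 0$ for $i=1,\ldots,n$, $h_0(\mathbf{s})=0$. A Laguerre history of length $n$ is a pair $(\mathbf{s},\mathbf{p})$ with $\mathbf{s}$ a 2-Motzkin path of length $n$ and $\mathbf{p}=(p_1,\ldots,p_n)$ with $0\le p_i\le h_{i-1}(\mathbf{s})$; $\mathcal{LH}_n$ denotes the set of Laguerre histories of length $n$. Fran\c con–Viennot bijection $\psi_{FV}:\mathfrak{S}_{n+1}\to\mathcal{LH}_n$: for $\sigma\in\mathfrak{S}_{n+1}$ with convention $\sigma(0)=\sigma(n+2)=0$, a value $\sigma(j)$ is a peak if $\sigma(j-1)<\sigma(j)>\sigma(j+1)$, a valley if $\sigma(j-1)>\sigma(j)<\sigma(j+1)$, a double ascent if $\sigma(j-1)<\sigma(j)<\sigma(j+1)$, a double descent if $\sigma(j-1)>\sigma(j)>\sigma(j+1)$. Then $\psi_{FV}(\sigma)=(\mathbf{s},\mathbf{p})$ with, for $i=1,\ldots,n$, $s_i=\textsc{U}$ if $i$ is a valley, $\textsc{D}$ if $i$ is a peak, $\textsc{L}_b$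 if $i$ is a double ascent, $\textsc{L}_r$ if $i$ is a double descent of $\sigma$, and $p_i=(2\text{ - }13)_i\sigma$, where $(2\text{ - }13)_i\sigma=\#\{j: i<j<n+1,\ \sigma(j)<\sigma(i)<\sigma(j+1)\}$ (the number of occurrences of the vincular pattern $2\text{ - }13$ in which the letter $i$ plays the role of the "2"). Yan–Zhou–Lin bijection $\psi_{YZL}:\mathfrak{S}_{n+1}\to\mathcal{LH}_n$: for $\sigma\in\mathfrak{S}_{n+1}$, $\psi_{YZL}(\sigma)=(\mathbf{s},\mathbf{p})$ where for $i=1,\ldots,n$: $s_i=\textsc{U}$ if $i<\sigma(i)$ and $i+1\le\sigma^{ -1}(i+1)$; $s_i=\textsc{D}$ if $i\ge\sigma(i)$ and $i+1>\sigma^{ -1}(i+1)$; $s_i=\textsc{L}_b$ if $i<\sigma(i)$ and $i+1>\sigma^{ -1}(i+1)$; $s_i=\textsc{L}_r$ if $i\ge\sigma(i)$ and $i+1\le\sigma^{ -1}(i+1)$; and $p_i=\mathsf{nest}_i\sigma=\#\{j: j<i<\sigma(i)<\sigma(j)\ \text{or}\ \sigma(j)<\sigma(i)\le i<j\}$. The bijection $\Phi$ on $\mathfrak{S}_m$ (Clarke–Steingr\'imsson–Zeng): for $\sigma\in\mathfrak{S}_m$, a letter $\sigma(i)$ is a descent top (resp. descent bottom) if $\sigma(i)>\sigma(i+1)$ (resp. $\sigma(i-1)>\sigma(i)$). For a letter $x=\sigma(i)$ let $(2\text{ - }31)_x\sigma=\#\{j: i<j<m,\ \sigma(j+1)<x<\sigma(j)\}$.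 Form two biwords $\binom{f}{f'}$ and $\binom{g}{g'}$, where $f$ (resp. $g$) is the increasing word of descent bottoms (resp. non-descent bottoms) of $\sigma$, and $f'$ (resp. $g'$) is the arrangement of the descent tops (resp. non-descent tops) of $\sigma$ such that the number of inversions in $f'$ having $x$ as bottom (resp. the number of inversions in $g'$ having $x$ as top) equals $(2\text{ - }31)_x\sigma$ for each letter $x$. Concatenate to obtain the biword $\binom{f\,g}{f'\,g'}$, rearrange its columns so that the bottom row is increasing; the top row is $\Phi(\sigma)$. The bijection $\Psi$ on $\mathfrak{S}_{n+1}$: given $\sigma\in\mathfrak{S}_{n+1}$, let $\hat\sigma\in\mathfrak{S}_{n+2}$ be $\hat\sigma=(\sigma(1)+1)(\sigma(2)+1)\cdots(\sigma(n+1)+1)\,1$ and $\tau=\Phi(\hat\sigma)$ (which satisfies $\tau(1)=n+2$); then $\Psi(\sigma)=\tau(2)\cdots\tau(n+2)\in\mathfrak{S}_{n+1}$. -}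

module Defs where

open import Data.Bool.Base using (if_then_else_)
open import Data.Fin.Base using (Fin; zero; suc; toℕ; fromℕ; fromℕ<; inject₁; punchIn; cast)
open import Data.Fin.Permutation using (Permutation′; Permutation; _⟨$⟩ʳ_; flip; insert; remove; cast-id; _∘ₚ_; inverseˡ; insert-punchIn; punchIn-permute)
import Data.Fin.Properties as Fin
open import Data.Fin.Properties using (toℕ<n; toℕ-fromℕ<; fromℕ<-toℕ; toℕ-injective; toℕ-fromℕ; toℕ-inject₁; toℕ-cast)
open import Data.Integer.Base as ℤ using (ℤ; 0ℤ)
import Data.Integer.Properties as ℤ
open import Data.List.Base using (List; []; _∷_; [_]; _++_; length; map; filter; zip; take; lookup; applyUpTo; applyDownFrom)
import Data.List.Base as List
import Data.List.Properties as List
open import Data.List.Membership.Propositional using (_∈_)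
open import Data.List.Membership.Propositional.Properties using (∈-filter⁺; ∈-filter⁻; ∈-applyUpTo⁺; ∈-applyUpTo⁻; ∈-++⁺ʳ)
open import Data.List.Relation.Binary.Permutation.Propositional using (_↭_; ↭-reflexive; ↭-sym; refl; prep; swap; trans; ↭⇒↭ₛ)
open import Data.List.Relation.Binary.Permutation.Propositional.Properties using (filter-↭; ↭-length; ↭-reverse; shift; ∈-resp-↭; All-resp-↭; ++⁺)
import Data.List.Relation.Binary.Permutation.Setoid as ↭ₛ
import Data.List.Relation.Binary.Permutation.Setoid.Properties as ↭ₛ
open import Data.List.Relation.Unary.All as All using (All; []; _∷_)
open import Data.List.Relation.Unary.AllPairs as AllPairs using (AllPairs; []; _∷_)
import Data.List.Relation.Unary.AllPairs.Properties as AllPairs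
import Data.List.Relation.Unary.Any.Properties as Any
open import Data.List.Relation.Unary.Any using (here; there)
open import Data.Nat.Base
open import Data.Nat.Properties
open import Data.Product.Base using (∃; ∃-syntax; _×_; _,_; proj₁; proj₂)
open import Data.Sum.Base using (_⊎_; inj₁; inj₂)
open import Data.Vec.Base as Vec using (Vec; []; _∷_; toList; tabulate)
import Data.Vec.Properties as Vec
open import Function.Base using (_∘_; case_of_)
open import Relation.Binary.Definitions using (tri<; tri≈; tri>)
open import Relation.Binary.PropositionalEquality as ≡ using (_≡_; _≢_; refl; cong; cong₂; subst; module ≡-Reasoning)
open import Relation.Nullary using (¬_; Dec; yes; no; does; contradiction)
open import Relation.Nullary.Decidable using (_×-dec_; _⊎-dec_; ¬?; dec-true; dec-false)
open import Relation.Unary using (Decidable)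
open import Algebra.Properties.CommutativeSemigroup +-commutativeSemigroup using (interchange)
open import Algebra.Properties.CommutativeMonoid.Sum +-0-commutativeMonoid using (sum; sum-permute)

-- σ ∈ 𝔖ₘ is a permutation of Fin m, whose elements 0, …, m-1 stand for the
-- letters 1, …, m.  `σ at j` is the letter σ(j) for 1 ≤ j ≤ m, with the
-- convention σ(0) = 0 and σ(j) = 0 for j > m.
infix 9 _at_
_at_ : ∀ {m} → Permutation′ m → ℕ → ℕ
σ at zero = 0
_at_ {m} σ (suc j) with j <? m
... | yes j<m = suc (toℕ (σ ⟨$⟩ʳ fromℕ< j<m))
... | no  _   = 0

-- The position σ⁻¹(x) of the letter x.
pos : ∀ {m} → Permutation′ m → ℕ → ℕ
pos σ x = flip σ at x

[1…_] : ℕ → List ℕ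
[1… m ] = applyUpTo suc m

count : ∀ {P : ℕ → Set} → Decidable P → List ℕ → ℕ
count P? xs = length (filter P? xs)

data Step : Set where
  U D Lᵣ Lb : Step

U? : (s : Step) → Dec (s ≡ U)
U? U  = yes refl
U? D  = no λ ()
U? Lᵣ = no λ ()
U? Lb = no λ ()

D? : (s : Step) → Dec (s ≡ D)
D? U  = no λ ()
D? D  = yes refl
D? Lᵣ = no λ ()
D? Lb = no λ ()

∣_∣U ∣_∣D : List Step → ℕ
∣ w ∣U = length (filter U? w)
∣ w ∣D = length (filter D? w)

height : ∀ {n} → Vec Step n → ℕ → ℤ
height s i = ℤ.+ ∣ take i (toList s) ∣U ℤ.- ℤ.+ ∣ take i (toList s) ∣D

record IsMotzkin {n} (s : Vec Step n) : Set where
  field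
    balanced    : ∣ toList s ∣U ≡ ∣ toList s ∣D
    nonNegative : ∀ i → i ≤ n → 0ℤ ℤ.≤ height s i

-- The index i : Fin n stands for i + 1, hence the bound hᵢ on pᵢ₊₁.  The
-- proofs are irrelevant, so that a history is determined by s and p.
record LaguerreHistory (n : ℕ) : Set where
  field
    s          : Vec Step n
    p          : Vec ℕ n
    .isMotzkin : IsMotzkin s
    .bounded   : ∀ (i : Fin n) → ℤ.+ Vec.lookup p i ℤ.≤ height s (toℕ i)

module _ {m} (σ : Permutation′ m) where

  Peak Valley DoubleAscent : ℕ → Set
  Peak         j = σ at pred j < σ at j × σ at j > σ at suc j
  Valley       j = σ at pred j > σ at j × σ at j < σ at suc j
  DoubleAscent j = σ at pred j < σ at j × σ at j < σ at suc j

  peak? : Decidable Peak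
  peak? j = (_ <? _) ×-dec (_ <? _)

  valley? : Decidable Valley
  valley? j = (_ <? _) ×-dec (_ <? _)

  doubleAscent? : Decidable DoubleAscent
  doubleAscent? j = (_ <? _) ×-dec (_ <? _)

  stepFV : ℕ → Step
  stepFV i =
    if does (valley? (pos σ i)) then U else
    if does (peak? (pos σ i)) then D else
    if does (doubleAscent? (pos σ i)) then Lb else Lᵣ

  Is2-13 : ℕ → ℕ → Set
  Is2-13 x j = (pos σ x < j × j < m) × (σ at j < x × x < σ at suc j)

  is2-13? : ∀ x → Decidable (Is2-13 x)
  is2-13? x j = ((_ <? _) ×-dec (_ <? _)) ×-dec ((_ <? _) ×-dec (_ <? _))

  -- Indexed by the letter x playing the role of the 2.
  pat2-13 : ℕ → ℕ
  pat2-13 x = count (is2-13? x) [1… m ]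

  stepYZL : ℕ → Step
  stepYZL i =
    if does (i <? σ at i)
    then if does (suc i ≤? pos σ (suc i)) then U else Lb
    else if does (suc i ≤? pos σ (suc i)) then Lᵣ else D

  IsNesting : ℕ → ℕ → Set
  IsNesting i j = (j < i × i < σ at i × σ at i < σ at j) ⊎ (σ at j < σ at i × σ at i ≤ i × i < j)

  isNesting? : ∀ i → Decidable (IsNesting i)
  isNesting? i j = ((_ <? _) ×-dec (_ <? _) ×-dec (_ <? _)) ⊎-dec ((_ <? _) ×-dec (_ ≤? _) ×-dec (_ <? _))

  nest : ℕ → ℕ
  nest i = count (isNesting? i) [1… m ]

  DescentTop DescentBottom : ℕ → Set
  DescentTop    x = pos σ x < m × x > σ at suc (pos σ x)
  DescentBottom x = 1 < pos σ x × σ at pred (pos σ x) > x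

  descentTop? : Decidable DescentTop
  descentTop? x = (_ <? _) ×-dec (_ <? _)

  descentBottom? : Decidable DescentBottom
  descentBottom? x = (_ <? _) ×-dec (_ <? _)

  descentTops nonDescentTops descentBottoms nonDescentBottoms : List ℕ
  descentTops       = filter descentTop? [1… m ]
  nonDescentTops    = filter (¬? ∘ descentTop?) [1… m ]
  descentBottoms    = filter descentBottom? [1… m ]
  nonDescentBottoms = filter (¬? ∘ descentBottom?) [1… m ]

  Is2-31 : ℕ → ℕ → Set
  Is2-31 x j = (pos σ x < j × j < m) × (σ at suc j < x × x < σ at j)

  is2-31? : ∀ x → Decidable (Is2-31 x)
  is2-31? x j = ((_ <? _) ×-dec (_ <? _)) ×-dec ((_ <? _) ×-dec (_ <? _))

  pat2-31 : ℕ → ℕ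
  pat2-31 x = count (is2-31? x) [1… m ]

-- Pairs of letters of a word, the first one standing to the left of the second.
pairs : List ℕ → List (ℕ × ℕ)
pairs []      = []
pairs (a ∷ w) = map (a ,_) w ++ pairs w

InvBottom InvTop : ℕ → ℕ × ℕ → Set
InvBottom x (a , b) = b < a × b ≡ x
InvTop    x (a , b) = b < a × a ≡ x

invBottom? : ∀ x → Decidable (InvBottom x)
invBottom? x (a , b) = (b <? a) ×-dec (b ≟ x)

invTop? : ∀ x → Decidable (InvTop x)
invTop? x (a , b) = (b <? a) ×-dec (a ≟ x)

#invBottom #invTop : ℕ → List ℕ → ℕ
#invBottom x w = length (filter (invBottom? x) (pairs w))
#invTop    x w = length (filter (invTop? x) (pairs w))

-- τ = Φ(σ): here f and g are the words descentBottoms σ and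
-- nonDescentBottoms σ, which are increasing.
record IsΦ {m} (σ τ : Permutation′ m) : Set where
  field
    f′ g′      : List ℕ
    f′-letters : f′ ↭ descentTops σ
    g′-letters : g′ ↭ nonDescentTops σ
    f′-inv     : ∀ x → x ∈ f′ → #invBottom x f′ ≡ pat2-31 σ x
    g′-inv     : ∀ x → x ∈ g′ → #invTop x g′ ≡ pat2-31 σ x
    columns    : zip (descentBottoms σ ++ nonDescentBottoms σ) (f′ ++ g′)
                 ↭ applyUpTo (λ i → (τ at suc i , suc i)) m

at-toℕ : ∀ {m} (σ : Permutation′ m) (i : Fin m) → σ at suc (toℕ i) ≡ suc (toℕ (σ ⟨$⟩ʳ i))
at-toℕ {m} σ i with toℕ i <? m
... | yes p = cong (λ j → suc (toℕ (σ ⟨$⟩ʳ j))) (fromℕ<-toℕ i p)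
... | no ¬p = contradiction (toℕ<n i) ¬p

asFin : ∀ {m j} → 1 ≤ j → j ≤ m → ∃[ i ] j ≡ suc (toℕ {m} i)
asFin {j = suc j} _ j≤m = fromℕ< j≤m , cong suc (≡.sym (toℕ-fromℕ< j≤m))

module _ {m} (σ : Permutation′ m) where

  at-≤ : ∀ j → σ at j ≤ m
  at-≤ zero = z≤n
  at-≤ (suc j) with j <? m
  ... | yes p = toℕ<n (σ ⟨$⟩ʳ fromℕ< p)
  ... | no  _ = z≤n

  at-beyond : ∀ j → m < j → σ at j ≡ 0
  at-beyond (suc j) m<j with j <? m
  ... | yes p = contradiction p (≤⇒≯ (s≤s⁻¹ m<j))
  ... | no  _ = refl

  at-≥1 : ∀ {j} → 1 ≤ j → j ≤ m → 1 ≤ σ at j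
  at-≥1 a b with asFin a b
  ... | i , refl rewrite at-toℕ σ i = s≤s z≤n

  pos-at : ∀ {j} → 1 ≤ j → j ≤ m → pos σ (σ at j) ≡ j
  pos-at a b with asFin a b
  ... | i , refl rewrite at-toℕ σ i | at-toℕ (flip σ) (σ ⟨$⟩ʳ i) = cong (suc ∘ toℕ) (inverseˡ σ)

module _ {m} (σ : Permutation′ m) where

  at-pos : ∀ {x} → 1 ≤ x → x ≤ m → σ at pos σ x ≡ x
  at-pos = pos-at (flip σ)

  pos-≥1 : ∀ {x} → 1 ≤ x → x ≤ m → 1 ≤ pos σ x
  pos-≥1 = at-≥1 (flip σ)

  pos-≤ : ∀ x → pos σ x ≤ m
  pos-≤ = at-≤ (flip σ)

ι : ∀ {P : Set} → Dec P → ℕ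
ι d = if does d then 1 else 0

ι-yes : ∀ {P : Set} (d : Dec P) → P → ι d ≡ 1
ι-yes (yes _) _ = refl
ι-yes (no ¬p) p = contradiction p ¬p

ι-no : ∀ {P : Set} (d : Dec P) → ¬ P → ι d ≡ 0
ι-no (yes p) ¬p = contradiction p ¬p
ι-no (no _)  _  = refl

ι-≤1 : ∀ {P : Set} (d : Dec P) → ι d ≤ 1
ι-≤1 (yes _) = s≤s z≤n
ι-≤1 (no _)  = z≤n

ι-mono : ∀ {P Q : Set} (d : Dec P) (e : Dec Q) → (P → Q) → ι d ≤ ι e
ι-mono (no _)  _ _ = z≤n
ι-mono (yes p) e f = ≤-reflexive (≡.sym (ι-yes e (f p)))

ι-cong : ∀ {P Q : Set} (d : Dec P) (e : Dec Q) → (P → Q) → (Q → P) → ι d ≡ ι e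
ι-cong d e f g = ≤-antisym (ι-mono d e f) (ι-mono e d g)

ι-+≤ : ∀ {P Q R : Set} (d : Dec P) (e : Dec Q) (f : Dec R) →
       (P → R) → (Q → R) → (P → ¬ Q) → ι d + ι e ≤ ι f
ι-+≤ (yes p) e f h k l rewrite ι-no e (l p) = ≤-reflexive (≡.sym (ι-yes f (h p)))
ι-+≤ (no ¬p) e f h k l = ι-mono e f k

ι-⊎ : ∀ {P Q R : Set} (d : Dec P) (e : Dec Q) (f : Dec R) →
      (P → R) → (Q → R) → (P → ¬ Q) → (R → P ⊎ Q) → ι d + ι e ≡ ι f
ι-⊎ (yes p) e f h k l r rewrite ι-no e (l p) = ≡.sym (ι-yes f (h p))
ι-⊎ (no ¬p) e f h k l r = ι-cong e f k λ x → case r x of λ where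
  (inj₁ p) → contradiction p ¬p
  (inj₂ q) → q

Σ< : ℕ → (ℕ → ℕ) → ℕ
Σ< zero    f = 0
Σ< (suc n) f = Σ< n f + f n

Σ-cong : ∀ n {f g} → (∀ k → k < n → f k ≡ g k) → Σ< n f ≡ Σ< n g
Σ-cong zero    h = refl
Σ-cong (suc n) h = cong₂ _+_ (Σ-cong n λ k k<n → h k (m<n⇒m<1+n k<n)) (h n ≤-refl)

Σ-mono : ∀ n {f g} → (∀ k → k < n → f k ≤ g k) → Σ< n f ≤ Σ< n g
Σ-mono zero    h = z≤n
Σ-mono (suc n) h = +-mono-≤ (Σ-mono n λ k k<n → h k (m<n⇒m<1+n k<n)) (h n ≤-refl)

Σ-+ : ∀ n f g → Σ< n (λ k → f k + g k) ≡ Σ< n f + Σ< n g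
Σ-+ zero    f g = refl
Σ-+ (suc n) f g = ≡.trans (cong (_+ (f n + g n)) (Σ-+ n f g)) (interchange (Σ< n f) (Σ< n g) (f n) (g n))

Σ-zero : ∀ n {f} → (∀ k → k < n → f k ≡ 0) → Σ< n f ≡ 0
Σ-zero zero    h = refl
Σ-zero (suc n) h = cong₂ _+_ (Σ-zero n λ k k<n → h k (m<n⇒m<1+n k<n)) (h n ≤-refl)

Σ-single : ∀ n {f} k → k < n → (∀ j → j < n → j ≢ k → f j ≡ 0) → Σ< n f ≡ f k
Σ-single (suc n) {f} k k<n h with k ≟ n
... | yes refl = cong (_+ f n) (Σ-zero n λ j j<n → h j (m<n⇒m<1+n j<n) (<⇒≢ j<n))
... | no k≢n   = ≡.trans
  (cong₂ _+_ (Σ-single n k (≤∧≢⇒< (s≤s⁻¹ k<n) k≢n) λ j j<n → h j (m<n⇒m<1+n j<n))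
             (h n ≤-refl (k≢n ∘ ≡.sym)))
  (+-identityʳ _)

Σ-head : ∀ n f → Σ< (suc n) f ≡ f 0 + Σ< n (f ∘ suc)
Σ-head zero    f = ≡.sym (+-identityʳ (f 0))
Σ-head (suc n) f = ≡.trans (cong (_+ f (suc n)) (Σ-head n f)) (+-assoc (f 0) _ _)

Σ-shift : ∀ m f → f 0 ≡ 0 → Σ< m (f ∘ suc) ≡ Σ< (suc m) f
Σ-shift m f f0≡0 = ≡.sym (≡.trans (Σ-head m f) (cong (_+ Σ< m (f ∘ suc)) f0≡0))

length-filter-Σ : ∀ {P : ℕ → Set} (P? : Decidable P) f n →
                  length (filter P? (applyUpTo f n)) ≡ Σ< n (λ k → ι (P? (f k)))
length-filter-Σ P? f zero = refl
length-filter-Σ P? f (suc n) = ≡.trans lem (≡.sym (Σ-head n (λ k → ι (P? (f k)))))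
  where
  lem : length (filter P? (applyUpTo f (suc n))) ≡ ι (P? (f 0)) + Σ< n (λ k → ι (P? (f (suc k))))
  lem with P? (f 0)
  ... | yes _ = cong suc (length-filter-Σ P? (f ∘ suc) n)
  ... | no  _ = length-filter-Σ P? (f ∘ suc) n

count-Σ : ∀ {P : ℕ → Set} (P? : Decidable P) m → count P? [1… m ] ≡ Σ< m (λ k → ι (P? (suc k)))
count-Σ P? m = length-filter-Σ P? suc m

Σ-sum : ∀ n f → Σ< n f ≡ sum {n} (λ i → f (toℕ i))
Σ-sum zero    f = refl
Σ-sum (suc n) f = ≡.trans (Σ-head n f) (cong (f 0 +_) (Σ-sum n (f ∘ suc)))

sum-ext : ∀ n {f g : Fin n → ℕ} → (∀ i → f i ≡ g i) → sum f ≡ sum g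
sum-ext zero    h = refl
sum-ext (suc n) h = cong₂ _+_ (h zero) (sum-ext n (h ∘ suc))

Σ-at : ∀ {m} (σ : Permutation′ m) g → Σ< m (λ k → g (σ at suc k)) ≡ Σ< m (λ k → g (suc k))
Σ-at {m} σ g = begin
  Σ< m (λ k → g (σ at suc k))             ≡⟨ Σ-sum m _ ⟩
  sum {m} (λ i → g (σ at suc (toℕ i)))        ≡⟨ sum-ext m (λ i → cong g (at-toℕ σ i)) ⟩
  sum (λ i → g (suc (toℕ (σ ⟨$⟩ʳ i))))    ≡⟨ sum-permute (λ i → g (suc (toℕ i))) σ ⟨
  sum {m} (λ i → g (suc (toℕ i)))         ≡⟨ Σ-sum m _ ⟨
  Σ< m (λ k → g (suc k))                  ∎
  where open ≡-Reasoning

∣∷∣U : ∀ a w → ∣ a ∷ w ∣U ≡ ι (U? a) + ∣ w ∣U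
∣∷∣U a w with U? a
... | yes _ = refl
... | no  _ = refl

∣∷∣D : ∀ a w → ∣ a ∷ w ∣D ≡ ι (D? a) + ∣ w ∣D
∣∷∣D a w with D? a
... | yes _ = refl
... | no  _ = refl

up-down : ∀ n (f : ℕ → Step) (H : ℕ → ℕ) →
          (∀ k → k < n → H (suc k) + ι (D? (f k)) ≡ H k + ι (U? (f k))) →
          ∀ i → i ≤ n → (let w = take i (toList (tabulate {n = n} (f ∘ toℕ)))) →
          H i + ∣ w ∣D ≡ H 0 + ∣ w ∣U
up-down n       f H step zero    _   = refl
up-down (suc n) f H step (suc i) i≤n = begin
  H (suc i) + ∣ f 0 ∷ w ∣D      ≡⟨ cong (H (suc i) +_) (≡.trans (∣∷∣D (f 0) w) (+-comm d ∣ w ∣D)) ⟩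
  H (suc i) + (∣ w ∣D + d)      ≡⟨ +-assoc (H (suc i)) ∣ w ∣D d ⟨
  H (suc i) + ∣ w ∣D + d        ≡⟨ cong (_+ d) (up-down n (f ∘ suc) (H ∘ suc) (λ k k<n → step (suc k) (s≤s k<n)) i (s≤s⁻¹ i≤n)) ⟩
  H 1 + ∣ w ∣U + d              ≡⟨ +-assoc (H 1) ∣ w ∣U d ⟩
  H 1 + (∣ w ∣U + d)            ≡⟨ cong (H 1 +_) (+-comm ∣ w ∣U d) ⟩
  H 1 + (d + ∣ w ∣U)            ≡⟨ +-assoc (H 1) d ∣ w ∣U ⟨
  H 1 + d + ∣ w ∣U              ≡⟨ cong (_+ ∣ w ∣U) (step 0 (s≤s z≤n)) ⟩
  H 0 + u + ∣ w ∣U              ≡⟨ +-assoc (H 0) u ∣ w ∣U ⟩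
  H 0 + (u + ∣ w ∣U)            ≡⟨ cong (H 0 +_) (∣∷∣U (f 0) w) ⟨
  H 0 + ∣ f 0 ∷ w ∣U            ∎
  where
  open ≡-Reasoning
  w = take i (toList (tabulate {n = n} (f ∘ suc ∘ toℕ)))
  d = ι (D? (f 0))
  u = ι (U? (f 0))

module _ {n} (f : ℕ → Step) (H : ℕ → ℕ) (H0≡0 : H 0 ≡ 0) (Hn≡0 : H n ≡ 0)
         (step : ∀ k → k < n → H (suc k) + ι (D? (f k)) ≡ H k + ι (U? (f k))) where

  private
    s : Vec Step n
    s = tabulate (f ∘ toℕ)

    level : ∀ i → i ≤ n → ∣ take i (toList s) ∣U ≡ H i + ∣ take i (toList s) ∣D
    level i i≤n = ≡.sym (≡.trans (up-down n f H step i i≤n) (cong (_+ ∣ take i (toList s) ∣U) H0≡0))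

  height-≡ : ∀ i → i ≤ n → height s i ≡ ℤ.+ H i
  height-≡ i i≤n = begin
    ℤ.+ u ℤ.- ℤ.+ d      ≡⟨ ℤ.m-n≡m⊖n u d ⟩
    u ℤ.⊖ d              ≡⟨ cong (ℤ._⊖ d) (level i i≤n) ⟩
    (H i + d) ℤ.⊖ d      ≡⟨ ℤ.⊖-≥ (m≤n+m d (H i)) ⟩
    ℤ.+ (H i + d ∸ d)    ≡⟨ cong ℤ.+_ (m+n∸n≡m (H i) d) ⟩
    ℤ.+ H i              ∎
    where
    open ≡-Reasoning
    u = ∣ take i (toList s) ∣U
    d = ∣ take i (toList s) ∣D

  tabulate-motzkin : IsMotzkin s
  tabulate-motzkin = record
    { balanced    = subst (λ w → ∣ w ∣U ≡ ∣ w ∣D) (List.take-all n (toList s) (≤-reflexive (Vec.length-toList s)))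
                      (≡.trans (level n ≤-refl) (cong (_+ ∣ take n (toList s) ∣D) Hn≡0))
    ; nonNegative = λ i i≤n → subst (0ℤ ℤ.≤_) (≡.sym (height-≡ i i≤n)) (ℤ.+≤+ z≤n)
    }

  tabulate-bounded : (q : ℕ → ℕ) → (∀ k → k < n → q k ≤ H k) →
                     ∀ (i : Fin n) → ℤ.+ Vec.lookup (tabulate (q ∘ toℕ)) i ℤ.≤ height s (toℕ i)
  tabulate-bounded q q≤H i
    rewrite Vec.lookup∘tabulate (q ∘ toℕ) i | height-≡ (toℕ i) (<⇒≤ (toℕ<n i)) = ℤ.+≤+ (q≤H (toℕ i) (toℕ<n i))

step-cancel : ∀ h′ h {L V u d} → h′ + L ≡ h + V → L + u ≡ V + d → h′ + d ≡ h + u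
step-cancel h′ h {L} {V} {u} {d} hL LU = +-cancelʳ-≡ L _ _ (begin
  h′ + d + L     ≡⟨ +-assoc h′ d L ⟩
  h′ + (d + L)   ≡⟨ cong (h′ +_) (+-comm d L) ⟩
  h′ + (L + d)   ≡⟨ +-assoc h′ L d ⟨
  h′ + L + d     ≡⟨ cong (_+ d) hL ⟩
  h + V + d      ≡⟨ +-assoc h V d ⟩
  h + (V + d)    ≡⟨ cong (h +_) LU ⟨
  h + (L + u)    ≡⟨ cong (h +_) (+-comm L u) ⟩
  h + (u + L)    ≡⟨ +-assoc h u L ⟨
  h + u + L      ∎)
  where open ≡-Reasoning

module _ {m} (σ : Permutation′ m) where

  pos-unique : ∀ j → 1 ≤ σ at j → pos σ (σ at j) ≡ j
  pos-unique zero ()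
  pos-unique (suc j) h = case suc j ≤? m of λ where
    (yes j<m) → pos-at σ (s≤s z≤n) j<m
    (no  j≮m) → contradiction (≡.sym (at-beyond σ (suc j) (≰⇒> j≮m))) (<⇒≢ h)

  suc-pred-pos : ∀ {x} → 1 ≤ x → x ≤ m → suc (pred (pos σ x)) ≡ pos σ x
  suc-pred-pos {x} 1≤x x≤m = suc-pred (pos σ x) ⦃ >-nonZero (pos-≥1 σ {x} 1≤x x≤m) ⦄

-- The ascents σ(k) ≤ v < σ(k+1), 0 ≤ k ≤ m; there is one more of them than
-- the height at v of the path of the Françon–Viennot bijection.
module FV {m} (σ : Permutation′ m) where

  cross? : ∀ v k → Dec (σ at k ≤ v × v < σ at suc k)
  cross? v k = (_ ≤? _) ×-dec (_ <? _)

  R : ℕ → ℕ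
  R v = Σ< (suc m) (λ k → ι (cross? v k))

  module _ (u : ℕ) (u<m : u < m) where
    private
      v = suc u
      k₀ = pos σ v
      a-k₀ : σ at k₀ ≡ v
      a-k₀ = at-pos σ (s≤s z≤n) u<m
      k₀-suc : suc (pred k₀) ≡ k₀
      k₀-suc = suc-pred-pos σ (s≤s z≤n) u<m
      at≡v : ∀ {j} → σ at j ≡ v → k₀ ≡ j
      at≡v {j} e = ≡.trans (cong (pos σ) (≡.sym e)) (pos-unique σ j (subst (1 ≤_) (≡.sym e) (s≤s z≤n)))

      X? : ∀ k → Dec (σ at k < v × σ at suc k ≡ v)
      X? k = (_ <? _) ×-dec (_ ≟ _)
      Y? : ∀ k → Dec (σ at k ≡ v × v < σ at suc k)
      Y? k = (_ ≟ _) ×-dec (_ <? _)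

      pointwise : ∀ k → ι (cross? v k) + ι (X? k) ≡ ι (cross? u k) + ι (Y? k)
      pointwise k = ≡.trans
        (ι-⊎ (cross? v k) (X? k) (cross? v k ⊎-dec X? k) inj₁ inj₂
          (λ { (_ , p) (_ , q) → <⇒≢ p (≡.sym q) }) (λ x → x))
        (≡.sym (ι-⊎ (cross? u k) (Y? k) (cross? v k ⊎-dec X? k)
          (λ { (p , q) → case m≤n⇒m<n∨m≡n q of λ where
                 (inj₁ v<) → inj₁ (m≤n⇒m≤1+n p , v<)
                 (inj₂ v≡) → inj₂ (s≤s p , ≡.sym v≡) })
          (λ { (p , q) → inj₁ (≤-reflexive p , q) })
          (λ { (p , _) (q , _) → <⇒≢ (s≤s p) q })
          (λ { (inj₁ (p , q)) → case m≤n⇒m<n∨m≡n p of λ where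
                 (inj₁ <v) → inj₁ (s≤s⁻¹ <v , <⇒≤ q)
                 (inj₂ ≡v) → inj₂ (≡v , q)
             ; (inj₂ (p , q)) → inj₁ (s≤s⁻¹ p , ≤-reflexive (≡.sym q)) })))

      ΣX : Σ< (suc m) (λ k → ι (X? k)) ≡ ι (σ at pred k₀ <? v)
      ΣX = ≡.trans
        (Σ-single (suc m) (pred k₀) (subst (_≤ suc m) (≡.sym k₀-suc) (m≤n⇒m≤1+n (pos-≤ σ v)))
          (λ j _ j≢ → ι-no (X? j) λ { (_ , e) → j≢ (cong pred (≡.sym (at≡v e))) }))
        (ι-cong (X? (pred k₀)) (_ <? _) proj₁ λ l<v → l<v , ≡.trans (cong (σ at_) k₀-suc) a-k₀)

      ΣY : Σ< (suc m) (λ k → ι (Y? k)) ≡ ι (v <? σ at suc k₀)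
      ΣY = ≡.trans
        (Σ-single (suc m) k₀ (s≤s (pos-≤ σ v))
          (λ j _ j≢ → ι-no (Y? j) λ { (e , _) → j≢ (≡.sym (at≡v e)) }))
        (ι-cong (Y? k₀) (_ <? _) proj₂ λ v<r → a-k₀ , v<r)

    R-step : R v + ι (σ at pred k₀ <? v) ≡ R u + ι (v <? σ at suc k₀)
    R-step = begin
      R v + ι (σ at pred k₀ <? v)                        ≡⟨ cong (R v +_) ΣX ⟨
      R v + Σ< (suc m) (λ k → ι (X? k))                  ≡⟨ Σ-+ (suc m) _ _ ⟨
      Σ< (suc m) (λ k → ι (cross? v k) + ι (X? k))       ≡⟨ Σ-cong (suc m) (λ k _ → pointwise k) ⟩
      Σ< (suc m) (λ k → ι (cross? u k) + ι (Y? k))       ≡⟨ Σ-+ (suc m) _ _ ⟩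
      R u + Σ< (suc m) (λ k → ι (Y? k))                  ≡⟨ cong (R u +_) ΣY ⟩
      R u + ι (v <? σ at suc k₀)                         ∎
      where open ≡-Reasoning

    step-ι : ι (σ at pred k₀ <? v) + ι (U? (stepFV σ v)) ≡ ι (v <? σ at suc k₀) + ι (D? (stepFV σ v))
    step-ι rewrite a-k₀ with <-cmp (σ at pred k₀) v | <-cmp v (σ at suc k₀)
    ... | tri≈ _ e _ | _ = contradiction (≡.sym (at≡v e)) (<⇒≢ (≤-reflexive k₀-suc))
    ... | tri< _ _ _ | tri≈ _ e _ = contradiction (at≡v (≡.sym e)) (<⇒≢ ≤-refl)
    ... | tri> _ _ _ | tri≈ _ e _ = contradiction (at≡v (≡.sym e)) (<⇒≢ ≤-refl)
    ... | tri< l<v _ l≯v | tri< v<r _ v≯r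
          rewrite dec-false (v <? σ at pred k₀) l≯v | dec-true (σ at pred k₀ <? v) l<v
                | dec-true (v <? σ at suc k₀) v<r | dec-false (σ at suc k₀ <? v) v≯r = refl
    ... | tri< l<v _ l≯v | tri> v≮r _ v>r
          rewrite dec-false (v <? σ at pred k₀) l≯v | dec-true (σ at pred k₀ <? v) l<v
                | dec-false (v <? σ at suc k₀) v≮r | dec-true (σ at suc k₀ <? v) v>r = refl
    ... | tri> l≮v _ l>v | tri< v<r _ v≯r
          rewrite dec-true (v <? σ at pred k₀) l>v | dec-false (σ at pred k₀ <? v) l≮v
                | dec-true (v <? σ at suc k₀) v<r = refl
    ... | tri> l≮v _ l>v | tri> v≮r _ v>r
          rewrite dec-true (v <? σ at pred k₀) l>v | dec-false (σ at pred k₀ <? v) l≮v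
                | dec-false (v <? σ at suc k₀) v≮r = refl

    private
      early : ∀ K → u < σ at K → 1 ≤ Σ< K (λ k → ι (cross? u k))
      early zero ()
      early (suc K) u<a with σ at K ≤? u
      ... | yes a≤u = ≤-trans (≤-reflexive (≡.sym (ι-yes (cross? u K) (a≤u , u<a)))) (m≤n+m _ _)
      ... | no  a≰u = ≤-trans (early K (≰⇒> a≰u)) (m≤m+n _ _)

      late : ∀ d → suc (Σ< (d + k₀) (λ k → ι (is2-13? σ v k))) ≤ Σ< (d + k₀) (λ k → ι (cross? u k))
      late zero = subst (λ z → suc z ≤ Σ< k₀ (λ k → ι (cross? u k)))
        (≡.sym (Σ-zero k₀ (λ k k<k₀ → ι-no (is2-13? σ v k) λ { ((k₀<k , _) , _) → <-asym k<k₀ k₀<k })))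
        (early k₀ (≤-reflexive (≡.sym a-k₀)))
      late (suc d) = +-mono-≤ (late d)
        (ι-mono (is2-13? σ v (d + k₀)) (cross? u (d + k₀)) λ { (_ , p , q) → s≤s⁻¹ p , <⇒≤ q })

    pat-<R : suc (pat2-13 σ v) ≤ R u
    pat-<R = subst₂′ (≡.sym pat-≡)
      (subst (λ z → suc (Σ< z (λ k → ι (is2-13? σ v k))) ≤ Σ< z (λ k → ι (cross? u k)))
        (m∸n+n≡m (m≤n⇒m≤1+n (pos-≤ σ v))) (late (suc m ∸ k₀)))
      where
      pat-≡ : pat2-13 σ v ≡ Σ< (suc m) (λ k → ι (is2-13? σ v k))
      pat-≡ = ≡.trans (count-Σ (is2-13? σ v) m)
        (Σ-shift m _ (ι-no (is2-13? σ v 0) λ { ((() , _) , _) }))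
      subst₂′ : ∀ {x y z} → x ≡ y → suc x ≤ z → suc y ≤ z
      subst₂′ refl p = p

  R-0 : R 0 ≡ 1 ⊎ m ≡ 0
  R-0 with m ≟ 0
  ... | yes e = inj₂ e
  ... | no m≢0 = inj₁ (≡.trans
    (Σ-single (suc m) 0 (s≤s z≤n) (λ j j≤m j≢0 → ι-no (cross? 0 j) λ { (p , _) →
      <⇒≢ (at-≥1 σ (n≢0⇒n>0 j≢0) (s≤s⁻¹ j≤m)) (≡.sym (n≤0⇒n≡0 p)) }))
    (ι-yes (cross? 0 0) (z≤n , at-≥1 σ ≤-refl (n≢0⇒n>0 m≢0))))

  R-m : R m ≡ 0
  R-m = Σ-zero (suc m) λ k _ → ι-no (cross? m k) λ { (_ , p) → <⇒≱ p (at-≤ σ (suc k)) }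

module _ {n} (σ : Permutation′ (suc n)) where
  open FV σ

  private
    H : ℕ → ℕ
    H = pred ∘ R

    R≡ : ∀ i → i ≤ n → R i ≡ suc (H i)
    R≡ i i≤n = ≡.sym (suc-pred (R i) ⦃ >-nonZero (≤-trans (s≤s z≤n) (pat-<R i (s≤s i≤n))) ⦄)

    H0≡0 : H 0 ≡ 0
    H0≡0 with R-0
    ... | inj₁ e = cong pred e

    Hn≡0 : H n ≡ 0
    Hn≡0 = n≤0⇒n≡0 (pred-mono-≤ (begin
      R n                                          ≤⟨ m≤m+n _ _ ⟩
      R n + ι (suc n <? σ at suc (pos σ (suc n)))  ≡⟨ R-step n ≤-refl ⟨
      R (suc n) + ι l<?                            ≡⟨ cong (_+ ι l<?) R-m ⟩
      ι l<?                                        ≤⟨ ι-≤1 l<? ⟩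
      1                                            ∎))
      where
      open ≤-Reasoning
      l<? = σ at pred (pos σ (suc n)) <? suc n

    H-step : ∀ k → k < n → H (suc k) + ι (D? (stepFV σ (suc k))) ≡ H k + ι (U? (stepFV σ (suc k)))
    H-step k k<n = step-cancel (H (suc k)) (H k) HL (step-ι k k<m)
      where
      k<m = m<n⇒m<1+n k<n
      L = ι (σ at pred (pos σ (suc k)) <? suc k)
      V = ι (suc k <? σ at suc (pos σ (suc k)))
      HL : H (suc k) + L ≡ H k + V
      HL = suc-injective (≡.trans (cong (_+ L) (≡.sym (R≡ (suc k) k<n)))
             (≡.trans (R-step k k<m) (cong (_+ V) (R≡ k (<⇒≤ k<n)))))

  ψFV : LaguerreHistory n
  ψFV = record
    { s         = tabulate (λ i → stepFV σ (suc (toℕ i)))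
    ; p         = tabulate (λ i → pat2-13 σ (suc (toℕ i)))
    ; isMotzkin = tabulate-motzkin (stepFV σ ∘ suc) H H0≡0 Hn≡0 H-step
    ; bounded   = tabulate-bounded (stepFV σ ∘ suc) H H0≡0 Hn≡0 H-step (pat2-13 σ ∘ suc)
                    (λ k k<n → pred-mono-≤ (pat-<R k (m<n⇒m<1+n k<n)))
    }

Σ-below : ∀ m t → t ≤ m → Σ< m (λ k → ι (suc k ≤? t)) ≡ t
Σ-below zero    .zero z≤n = refl
Σ-below (suc m) t t≤1+m with m≤n⇒m<n∨m≡n t≤1+m
... | inj₁ t<1+m = ≡.trans
  (cong₂ _+_ (Σ-below m t (s≤s⁻¹ t<1+m)) (ι-no (suc m ≤? t) (<⇒≱ t<1+m)))
  (+-identityʳ t)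
... | inj₂ refl = ≡.trans
  (cong₂ _+_
    (≡.trans (Σ-cong m λ k k<m → ι-cong (suc k ≤? suc m) (suc k ≤? m) (λ _ → k<m) (λ _ → m<n⇒m<1+n k<m))
             (Σ-below m m ≤-refl))
    (ι-yes (suc m ≤? suc m) ≤-refl))
  (+-comm m 1)

-- A i = #{ j ≤ i : σ(j) > i + 1 } is the height at i of the path of the
-- Yan–Zhou–Lin bijection.
module YZL {m} (σ : Permutation′ m) where

  A? : ∀ i k → Dec (k < i × suc i < σ at suc k)
  A? i k = (_ <? _) ×-dec (_ <? _)

  A : ℕ → ℕ
  A i = Σ< m (λ k → ι (A? i k))

  module _ (i : ℕ) (t<m : suc i < m) where
    private
      t = suc i
      p = pos σ (suc t)
      p-suc : suc (pred p) ≡ p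
      p-suc = suc-pred-pos σ (s≤s z≤n) t<m
      a-p : σ at suc (pred p) ≡ suc t
      a-p = ≡.trans (cong (σ at_) p-suc) (at-pos σ (s≤s z≤n) t<m)

      X? : ∀ k → Dec (k < t × σ at suc k ≡ suc t)
      X? k = (_ <? _) ×-dec (_ ≟ _)
      Y? : ∀ k → Dec (k ≡ i × t < σ at suc k)
      Y? k = (_ ≟ _) ×-dec (_ <? _)
      M? : ∀ k → Dec (k < t × t < σ at suc k)
      M? k = (_ <? _) ×-dec (_ <? _)

      pointwise : ∀ k → ι (A? t k) + ι (X? k) ≡ ι (A? i k) + ι (Y? k)
      pointwise k = ≡.trans
        (ι-⊎ (A? t k) (X? k) (M? k)
          (λ { (a , b) → a , <⇒≤ b })
          (λ { (a , b) → a , ≤-reflexive (≡.sym b) })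
          (λ { (_ , b) (_ , c) → <⇒≢ b (≡.sym c) })
          (λ { (a , b) → case m≤n⇒m<n∨m≡n b of λ where
                 (inj₁ c) → inj₁ (a , c)
                 (inj₂ c) → inj₂ (a , ≡.sym c) }))
        (≡.sym (ι-⊎ (A? i k) (Y? k) (M? k)
          (λ { (a , b) → m<n⇒m<1+n a , b })
          (λ { (a , b) → ≤-reflexive (cong suc a) , b })
          (λ { (a , _) (b , _) → <⇒≢ a b })
          (λ { (a , b) → case m≤n⇒m<n∨m≡n (s≤s⁻¹ a) of λ where
                 (inj₁ c) → inj₁ (c , b)
                 (inj₂ c) → inj₂ (c , b) })))

      ΣX : Σ< m (λ k → ι (X? k)) ≡ ι (p ≤? t)
      ΣX = ≡.trans
        (Σ-single m (pred p) (subst (_≤ m) (≡.sym p-suc) (pos-≤ σ (suc t)))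
          (λ j _ j≢ → ι-no (X? j) λ { (_ , e) → j≢ (cong pred (≡.trans
            (≡.sym (pos-unique σ (suc j) (subst (1 ≤_) (≡.sym e) (s≤s z≤n)))) (cong (pos σ) e))) }))
        (ι-cong (X? (pred p)) (p ≤? t)
          (λ { (a , _) → subst (_≤ t) p-suc a })
          (λ p≤t → subst (_≤ t) (≡.sym p-suc) p≤t , a-p))

      ΣY : Σ< m (λ k → ι (Y? k)) ≡ ι (t <? σ at t)
      ΣY = ≡.trans
        (Σ-single m i (<⇒≤ t<m) (λ j _ j≢ → ι-no (Y? j) λ { (e , _) → j≢ e }))
        (ι-cong (Y? i) (t <? σ at t) proj₂ λ b → refl , b)

    A-step : A t + ι (p ≤? t) ≡ A i + ι (t <? σ at t)
    A-step = begin
      A t + ι (p ≤? t)                             ≡⟨ cong (A t +_) ΣX ⟨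
      A t + Σ< m (λ k → ι (X? k))                  ≡⟨ Σ-+ m _ _ ⟨
      Σ< m (λ k → ι (A? t k) + ι (X? k))           ≡⟨ Σ-cong m (λ k _ → pointwise k) ⟩
      Σ< m (λ k → ι (A? i k) + ι (Y? k))           ≡⟨ Σ-+ m _ _ ⟩
      A i + Σ< m (λ k → ι (Y? k))                  ≡⟨ cong (A i +_) ΣY ⟩
      A i + ι (t <? σ at t)                        ∎
      where open ≡-Reasoning

    step-ι : ι (p ≤? t) + ι (U? (stepYZL σ t)) ≡ ι (t <? σ at t) + ι (D? (stepYZL σ t))
    step-ι = cases (<-≤-connex t (σ at t)) (≤-<-connex p t)
      where
      cases : t < σ at t ⊎ σ at t ≤ t → p ≤ t ⊎ t < p →
              ι (p ≤? t) + ι (U? (stepYZL σ t)) ≡ ι (t <? σ at t) + ι (D? (stepYZL σ t))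
      cases (inj₁ a) (inj₁ b) rewrite dec-true (t <? σ at t) a | dec-true (p ≤? t) b | dec-false (t <? p) (≤⇒≯ b) = refl
      cases (inj₁ a) (inj₂ b) rewrite dec-true (t <? σ at t) a | dec-false (p ≤? t) (<⇒≱ b) | dec-true (t <? p) b = refl
      cases (inj₂ a) (inj₁ b) rewrite dec-false (t <? σ at t) (≤⇒≯ a) | dec-true (p ≤? t) b | dec-false (t <? p) (≤⇒≯ b) = refl
      cases (inj₂ a) (inj₂ b) rewrite dec-false (t <? σ at t) (≤⇒≯ a) | dec-false (p ≤? t) (<⇒≱ b) | dec-true (t <? p) b = refl

  nest-≤A : ∀ i → suc i ≤ m → nest σ (suc i) ≤ A i
  nest-≤A i t≤m = subst (_≤ A i) (≡.sym (count-Σ N? m)) (cases (<-≤-connex t (σ at t)))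
    where
    t = suc i
    N? = isNesting? σ t
    ΣN = Σ< m (λ k → ι (N? (suc k)))

    cases : t < σ at t ⊎ σ at t ≤ t → ΣN ≤ A i
    cases (inj₁ t<a) = Σ-mono m λ k _ → ι-mono (N? (suc k)) (A? i k) λ where
      (inj₁ (a , b , c)) → s≤s⁻¹ a , <-trans b c
      (inj₂ (_ , b , _)) → contradiction b (<⇒≱ t<a)
    cases (inj₂ a≤t) = +-cancelˡ-≤ ΣB ΣN (A i) (s≤s⁻¹ (begin
      suc (ΣB + ΣN)                                      ≡⟨ cong (λ z → z + ΣB + ΣN) ΣE ⟨
      ΣE′ + ΣB + ΣN                                      ≡⟨ cong (_+ ΣN) (+-comm ΣE′ ΣB) ⟩
      ΣB + ΣE′ + ΣN                                      ≡⟨ cong (_+ ΣN) (Σ-+ m _ _) ⟨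
      Σ< m (λ k → ι (B? k) + ι (k ≟ i)) + ΣN             ≡⟨ Σ-+ m _ _ ⟨
      Σ< m (λ k → ι (B? k) + ι (k ≟ i) + ι (N? (suc k))) ≤⟨ Σ-mono m (λ k _ → pointwise k) ⟩
      Σ< m (λ k → ι (σ at suc k ≤? t))                   ≡⟨ Σ-at σ (λ x → ι (x ≤? t)) ⟩
      Σ< m (λ k → ι (suc k ≤? t))                        ≡⟨ Σ-below m t t≤m ⟩
      suc i                                              ≡⟨ cong suc (Σ-below m i (<⇒≤ t≤m)) ⟨
      suc (Σ< m (λ k → ι (suc k ≤? i)))                  ≡⟨ cong suc (Σ-cong m (λ k _ → split k)) ⟨
      suc (Σ< m (λ k → ι (B? k) + ι (A? i k)))           ≡⟨ cong suc (Σ-+ m _ _) ⟩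
      suc (ΣB + A i)                                     ∎))
      where
      open ≤-Reasoning
      B? : ∀ k → Dec (k < i × σ at suc k ≤ t)
      B? k = (_ <? _) ×-dec (_ ≤? _)
      ΣB = Σ< m (λ k → ι (B? k))
      ΣE′ = Σ< m (λ k → ι (k ≟ i))
      ΣE : ΣE′ ≡ 1
      ΣE = ≡.trans (Σ-single m i t≤m (λ j _ j≢ → ι-no (j ≟ i) j≢)) (ι-yes (i ≟ i) refl)
      split : ∀ k → ι (B? k) + ι (A? i k) ≡ ι (k <? i)
      split k = ι-⊎ (B? k) (A? i k) (k <? i) proj₁ proj₁
        (λ { (_ , a) (_ , b) → <⇒≱ b a })
        (λ a → case ≤-<-connex (σ at suc k) t of λ where
          (inj₁ b) → inj₁ (a , b)
          (inj₂ b) → inj₂ (a , b))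
      pointwise : ∀ k → ι (B? k) + ι (k ≟ i) + ι (N? (suc k)) ≤ ι (σ at suc k ≤? t)
      pointwise k = ≤-trans
        (+-monoˡ-≤ (ι (N? (suc k)))
          (ι-+≤ (B? k) (k ≟ i) (B? k ⊎-dec (k ≟ i)) inj₁ inj₂ (λ { (a , _) e → <⇒≢ a e })))
        (ι-+≤ (B? k ⊎-dec (k ≟ i)) (N? (suc k)) (σ at suc k ≤? t)
          (λ { (inj₁ (_ , a)) → a ; (inj₂ refl) → a≤t })
          (λ { (inj₁ (_ , a , _)) → contradiction a≤t (<⇒≱ a) ; (inj₂ (a , b , _)) → ≤-trans (<⇒≤ a) b })
          (λ { _ (inj₁ (_ , a , _)) → contradiction a≤t (<⇒≱ a)
             ; (inj₁ (a , _)) (inj₂ (_ , _ , b)) → <-asym a (s≤s⁻¹ b)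
             ; (inj₂ refl) (inj₂ (_ , _ , b)) → <-irrefl refl b }))

module _ {n} (σ : Permutation′ (suc n)) where
  open YZL σ

  private
    A0≡0 : A 0 ≡ 0
    A0≡0 = Σ-zero (suc n) λ k _ → ι-no (A? 0 k) λ { (() , _) }

    An≡0 : A n ≡ 0
    An≡0 = Σ-zero (suc n) λ k _ → ι-no (A? n k) λ { (_ , p) → <⇒≱ p (at-≤ σ (suc k)) }

    A-step′ : ∀ k → k < n → A (suc k) + ι (D? (stepYZL σ (suc k))) ≡ A k + ι (U? (stepYZL σ (suc k)))
    A-step′ k k<n = step-cancel (A (suc k)) (A k) (A-step k (s≤s k<n)) (step-ι k (s≤s k<n))

  ψYZL : LaguerreHistory n
  ψYZL = record
    { s         = tabulate (λ i → stepYZL σ (suc (toℕ i)))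
    ; p         = tabulate (λ i → nest σ (suc (toℕ i)))
    ; isMotzkin = tabulate-motzkin (stepYZL σ ∘ suc) A A0≡0 An≡0 A-step′
    ; bounded   = tabulate-bounded (stepYZL σ ∘ suc) A A0≡0 An≡0 A-step′ (nest σ ∘ suc)
                    (λ k k<n → nest-≤A k (m<n⇒m<1+n k<n))
    }

length-filter-∷ : ∀ {A : Set} {P : A → Set} (P? : Decidable P) x xs →
                  length (filter P? (x ∷ xs)) ≡ ι (P? x) + length (filter P? xs)
length-filter-∷ P? x xs with P? x
... | yes _ = refl
... | no  _ = refl

length-filter-++∷ : ∀ {A : Set} {P : A → Set} (P? : Decidable P) u x v →
                    length (filter P? (u ++ x ∷ v)) ≡ ι (P? x) + length (filter P? (u ++ v))
length-filter-++∷ P? u x v =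
  ≡.trans (↭-length (filter-↭ P? (shift x u v))) (length-filter-∷ P? x (u ++ v))

length-filter-map : ∀ {A B : Set} {P : B → Set} (P? : Decidable P) (f : A → B) xs →
                    length (filter P? (map f xs)) ≡ length (filter (P? ∘ f) xs)
length-filter-map P? f []       = refl
length-filter-map P? f (x ∷ xs) = ≡.trans (length-filter-∷ P? (f x) (map f xs))
  (≡.trans (cong (ι (P? (f x)) +_) (length-filter-map P? f xs)) (≡.sym (length-filter-∷ (P? ∘ f) x xs)))

length-filter-filter : ∀ {P Q : ℕ → Set} (P? : Decidable P) (Q? : Decidable Q) xs →
                       length (filter Q? (filter P? xs)) ≡ length (filter (λ x → P? x ×-dec Q? x) xs)
length-filter-filter P? Q? [] = refl
length-filter-filter P? Q? (x ∷ xs) with P? x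
... | no  _ = length-filter-filter P? Q? xs
... | yes _ with Q? x
...   | no  _ = length-filter-filter P? Q? xs
...   | yes _ = cong suc (length-filter-filter P? Q? xs)

length-filter-none : ∀ {A : Set} {P : A → Set} (P? : Decidable P) {xs} →
                     All (λ x → ¬ P x) xs → length (filter P? xs) ≡ 0
length-filter-none P? h = cong length (List.filter-none P? h)

filter-partition : ∀ {P : ℕ → Set} (P? : Decidable P) xs → filter P? xs ++ filter (¬? ∘ P?) xs ↭ xs
filter-partition P? [] = refl
filter-partition P? (x ∷ xs) with P? x
... | yes _ = prep x (filter-partition P? xs)
... | no  _ = trans (shift x (filter P? xs) _) (prep x (filter-partition P? xs))

letter-bounds : ∀ {m x} → x ∈ [1… m ] → 1 ≤ x × x ≤ m
letter-bounds x∈ with ∈-applyUpTo⁻ suc x∈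
... | i , i<m , refl = s≤s z≤n , i<m

module _ {m} (σ : Permutation′ m) where

  2-31-bound-top : ∀ x → pat2-31 σ x ≤ length (filter (x <?_) (descentTops σ))
  2-31-bound-top x = begin
    pat2-31 σ x                                       ≡⟨ count-Σ (is2-31? σ x) m ⟩
    Σ< m (λ k → ι (is2-31? σ x (suc k)))              ≤⟨ Σ-mono m pointwise ⟩
    Σ< m (λ k → ι (G? (σ at suc k)))                  ≡⟨ Σ-at σ (λ y → ι (G? y)) ⟩
    Σ< m (λ k → ι (G? (suc k)))                       ≡⟨ count-Σ G? m ⟨
    count G? [1… m ]                                  ≡⟨ length-filter-filter (descentTop? σ) (x <?_) [1… m ] ⟨
    length (filter (x <?_) (descentTops σ))           ∎
    where
    open ≤-Reasoning
    G? : ∀ y → Dec (DescentTop σ y × x < y)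
    G? y = descentTop? σ y ×-dec (x <? y)
    pointwise : ∀ k → k < m → ι (is2-31? σ x (suc k)) ≤ ι (G? (σ at suc k))
    pointwise k k<m = ι-mono (is2-31? σ x (suc k)) (G? (σ at suc k)) λ { ((_ , j<m) , (a , b)) →
      subst (λ j → j < m × σ at suc k > σ at suc j) (≡.sym (pos-at σ (s≤s z≤n) k<m)) (j<m , <-trans a b) , b }

  2-31-bound-nonTop : ∀ x → 1 ≤ x → x ≤ m → pat2-31 σ x ≤ length (filter (_<? x) (nonDescentTops σ))
  2-31-bound-nonTop x 1≤x x≤m = begin
    pat2-31 σ x                                       ≡⟨ count-Σ P? m ⟩
    Σ< m (λ k → ι (P? (suc k)))                       ≡⟨ Σ-shift m _ (ι-no (P? 0) λ { ((() , _) , _) }) ⟩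
    Σ< m (λ k → ι (P? k)) + ι (P? m)                  ≡⟨ cong (Σ< m (λ k → ι (P? k)) +_) (ι-no (P? m) λ { ((_ , p) , _) → <-irrefl refl p }) ⟩
    Σ< m (λ k → ι (P? k)) + 0                         ≡⟨ +-identityʳ _ ⟩
    Σ< m (λ k → ι (P? k))                             ≤⟨ subst (λ z → Σ< z (λ k → ι (P? k)) ≤ Σ< z (λ k → ι (up? k)) + ι (σ at z <? x)) (m∸n+n≡m (pos-≤ σ x)) (crossings (m ∸ k₀)) ⟩
    Σ< m (λ k → ι (up? k)) + ι (σ at m <? x)          ≤⟨ +-mono-≤ (Σ-mono m up-N) last-N ⟩
    Σ< (suc m) (λ k → ι (N? k))                       ≡⟨ Σ-shift m _ (ι-no (N? 0) λ { (() , _) }) ⟨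
    Σ< m (λ k → ι (N? (suc k)))                       ≤⟨ Σ-mono m (λ k _ → ι-mono (N? (suc k)) (G? (σ at suc k)) proj₂) ⟩
    Σ< m (λ k → ι (G? (σ at suc k)))                  ≡⟨ Σ-at σ (λ y → ι (G? y)) ⟩
    Σ< m (λ k → ι (G? (suc k)))                       ≡⟨ count-Σ G? m ⟨
    count G? [1… m ]                                  ≡⟨ length-filter-filter (¬? ∘ descentTop? σ) (_<? x) [1… m ] ⟨
    length (filter (_<? x) (nonDescentTops σ))        ∎
    where
    open ≤-Reasoning
    k₀ = pos σ x
    1≤k₀ : 1 ≤ k₀
    1≤k₀ = pos-≥1 σ 1≤x x≤m
    P? = is2-31? σ x
    G? : ∀ y → Dec (¬ DescentTop σ y × y < x)
    G? y = ¬? (descentTop? σ y) ×-dec (y <? x)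
    N? : ∀ k → Dec (1 ≤ k × (¬ DescentTop σ (σ at k) × σ at k < x))
    N? k = (1 ≤? k) ×-dec G? (σ at k)
    up? : ∀ k → Dec (k₀ ≤ k × σ at k < x × x ≤ σ at suc k)
    up? k = (_ ≤? _) ×-dec (_ <? _) ×-dec (_ ≤? _)

    crossings : ∀ d → Σ< (d + k₀) (λ k → ι (P? k)) ≤ Σ< (d + k₀) (λ k → ι (up? k)) + ι (σ at (d + k₀) <? x)
    crossings zero rewrite Σ-zero k₀ {λ k → ι (P? k)} (λ k k<k₀ → ι-no (P? k) λ { ((p , _) , _) → <-asym p k<k₀ }) = z≤n
    crossings (suc d) = begin
      Σ< K (λ k → ι (P? k)) + ι (P? K)                            ≤⟨ +-monoˡ-≤ (ι (P? K)) (crossings d) ⟩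
      Σ< K (λ k → ι (up? k)) + ι (σ at K <? x) + ι (P? K)         ≡⟨ +-assoc (Σ< K (λ k → ι (up? k))) _ _ ⟩
      Σ< K (λ k → ι (up? k)) + (ι (σ at K <? x) + ι (P? K))       ≤⟨ +-monoʳ-≤ (Σ< K (λ k → ι (up? k))) (local (<-≤-connex (σ at suc K) x)) ⟩
      Σ< K (λ k → ι (up? k)) + (ι (up? K) + ι (σ at suc K <? x))  ≡⟨ +-assoc (Σ< K (λ k → ι (up? k))) _ _ ⟨
      Σ< (suc K) (λ k → ι (up? k)) + ι (σ at suc K <? x)          ∎
      where
      K = d + k₀
      local : σ at suc K < x ⊎ x ≤ σ at suc K →
              ι (σ at K <? x) + ι (P? K) ≤ ι (up? K) + ι (σ at suc K <? x)
      local (inj₁ a) = ≤-trans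
        (ι-+≤ (σ at K <? x) (P? K) (σ at suc K <? x) (λ _ → a) (λ _ → a) (λ { p (_ , _ , q) → <-asym p q }))
        (m≤n+m _ _)
      local (inj₂ a) = ≤-trans
        (ι-+≤ (σ at K <? x) (P? K) (up? K) (λ p → m≤n+m k₀ d , p , a)
          (λ { (_ , p , _) → contradiction a (<⇒≱ p) }) (λ { p (_ , _ , q) → <-asym p q }))
        (m≤m+n _ _)

    up-N : ∀ k → k < m → ι (up? k) ≤ ι (N? k)
    up-N k k<m = ι-mono (up? k) (N? k) λ { (p , q , r) → let 1≤k = ≤-trans 1≤k₀ p in
      1≤k , (λ { (_ , s) → <-asym s (subst (λ j → σ at k < σ at suc j) (≡.sym (pos-at σ 1≤k (<⇒≤ k<m))) (<-≤-trans q r)) }) , q }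

    last-N : ι (σ at m <? x) ≤ ι (N? m)
    last-N = ι-mono (σ at m <? x) (N? m) λ p → let 1≤m = ≤-trans 1≤x x≤m in
      1≤m , (λ { (q , _) → <-irrefl (pos-at σ 1≤m ≤-refl) q }) , p

#invBottom-∷ : ∀ x a w → #invBottom x (a ∷ w) ≡ length (filter (λ b → invBottom? x (a , b)) w) + #invBottom x w
#invBottom-∷ x a w
  rewrite List.filter-++ (invBottom? x) (map (a ,_) w) (pairs w)
        | List.length-++ (filter (invBottom? x) (map (a ,_) w)) {filter (invBottom? x) (pairs w)}
        | length-filter-map (invBottom? x) (a ,_) w = refl

#invTop-∷ : ∀ x a w → #invTop x (a ∷ w) ≡ length (filter (λ b → invTop? x (a , b)) w) + #invTop x w
#invTop-∷ x a w
  rewrite List.filter-++ (invTop? x) (map (a ,_) w) (pairs w)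
        | List.length-++ (filter (invTop? x) (map (a ,_) w)) {filter (invTop? x) (pairs w)}
        | length-filter-map (invTop? x) (a ,_) w = refl

#invBottom-none : ∀ x w → All (_≢ x) w → #invBottom x w ≡ 0
#invBottom-none x []      []        = refl
#invBottom-none x (a ∷ w) (_ ∷ w≢x) = ≡.trans (#invBottom-∷ x a w)
  (cong₂ _+_ (length-filter-none _ (All.map (λ b≢x → λ { (_ , e) → b≢x e }) w≢x)) (#invBottom-none x w w≢x))

#invTop-none : ∀ x w → All (_≢ x) w → #invTop x w ≡ 0
#invTop-none x []      []          = refl
#invTop-none x (a ∷ w) (a≢x ∷ w≢x) = ≡.trans (#invTop-∷ x a w)
  (cong₂ _+_ (length-filter-none _ (All.universal (λ _ → λ { (_ , e) → a≢x e }) w)) (#invTop-none x w w≢x))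

-- Inserting a new smallest letter x, resp. a new largest one, into a word.
#invBottom-insert : ∀ y x u v → All (x <_) (u ++ v) →
                    #invBottom y (u ++ x ∷ v) ≡ ι (x ≟ y) * length u + #invBottom y (u ++ v)
#invBottom-insert y x [] v x<v = ≡.trans (#invBottom-∷ y x v)
  (cong (_+ #invBottom y v) (≡.trans
    (length-filter-none _ (All.map (λ x<b → λ { (b<x , _) → <-asym x<b b<x }) x<v))
    (≡.sym (*-zeroʳ (ι (x ≟ y))))))
#invBottom-insert y x (a ∷ u) v (x<a ∷ x<uv) = begin
  #invBottom y (a ∷ u ++ x ∷ v)                          ≡⟨ #invBottom-∷ y a (u ++ x ∷ v) ⟩
  length (filter Q? (u ++ x ∷ v)) + #invBottom y (u ++ x ∷ v)
                                                         ≡⟨ cong₂ _+_ (length-filter-++∷ Q? u x v) (#invBottom-insert y x u v x<uv) ⟩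
  (ι (Q? x) + q) + (e * length u + #invBottom y (u ++ v))  ≡⟨ cong (λ z → (z + q) + (e * length u + #invBottom y (u ++ v))) (ι-cong (Q? x) (x ≟ y) proj₂ (x<a ,_)) ⟩
  (e + q) + (e * length u + #invBottom y (u ++ v))       ≡⟨ interchange e q (e * length u) _ ⟩
  (e + e * length u) + (q + #invBottom y (u ++ v))       ≡⟨ cong₂ _+_ (*-suc e (length u)) (#invBottom-∷ y a (u ++ v)) ⟨
  e * suc (length u) + #invBottom y (a ∷ u ++ v)         ∎
  where
  open ≡-Reasoning
  Q? = λ b → invBottom? y (a , b)
  q = length (filter Q? (u ++ v))
  e = ι (x ≟ y)

#invTop-insert : ∀ y x u v → All (_< x) (u ++ v) →
                 #invTop y (u ++ x ∷ v) ≡ ι (x ≟ y) * length v + #invTop y (u ++ v)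
#invTop-insert y x [] v v<x = ≡.trans (#invTop-∷ y x v) (cong (_+ #invTop y v) (base v v<x))
  where
  base : ∀ v → All (_< x) v → length (filter (λ b → invTop? y (x , b)) v) ≡ ι (x ≟ y) * length v
  base []      []          = ≡.sym (*-zeroʳ (ι (x ≟ y)))
  base (b ∷ v) (b<x ∷ v<x) = ≡.trans (length-filter-∷ _ b v) (≡.trans
    (cong₂ _+_ (ι-cong (invTop? y (x , b)) (x ≟ y) proj₂ (b<x ,_)) (base v v<x))
    (≡.sym (*-suc (ι (x ≟ y)) (length v))))
#invTop-insert y x (a ∷ u) v (a<x ∷ uv<x) = begin
  #invTop y (a ∷ u ++ x ∷ v)                             ≡⟨ #invTop-∷ y a (u ++ x ∷ v) ⟩
  length (filter Q? (u ++ x ∷ v)) + #invTop y (u ++ x ∷ v)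
                                                         ≡⟨ cong₂ _+_ (length-filter-++∷ Q? u x v) (#invTop-insert y x u v uv<x) ⟩
  (ι (Q? x) + q) + (e * length v + #invTop y (u ++ v))   ≡⟨ cong (λ z → (z + q) + (e * length v + #invTop y (u ++ v))) (ι-no (Q? x) λ { (x<a , _) → <-asym x<a a<x }) ⟩
  q + (e * length v + #invTop y (u ++ v))                ≡⟨ +-assoc q _ _ ⟨
  q + e * length v + #invTop y (u ++ v)                  ≡⟨ cong (_+ #invTop y (u ++ v)) (+-comm q _) ⟩
  e * length v + q + #invTop y (u ++ v)                  ≡⟨ +-assoc (e * length v) q _ ⟩
  e * length v + (q + #invTop y (u ++ v))                ≡⟨ cong (e * length v +_) (#invTop-∷ y a (u ++ v)) ⟨
  e * length v + #invTop y (a ∷ u ++ v)                  ∎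
  where
  open ≡-Reasoning
  Q? = λ b → invTop? y (a , b)
  q = length (filter Q? (u ++ v))
  e = ι (x ≟ y)

arrangeBottom : ∀ (c : ℕ → ℕ) xs → AllPairs _<_ xs →
                (∀ x → x ∈ xs → c x ≤ length (filter (x <?_) xs)) →
                ∃[ w ] w ↭ xs × (∀ x → x ∈ w → #invBottom x w ≡ c x)
arrangeBottom c []       _            _     = [] , refl , λ _ ()
arrangeBottom c (x ∷ xs) (x<xs ∷ xs↗) bound =
  u ++ x ∷ v , trans (shift x u v) (prep x uv↭xs) , inv
  where
  rec = arrangeBottom c xs xs↗ λ z z∈ →
    subst (λ l → c z ≤ length l) (List.filter-reject (z <?_) (λ z<x → <-asym z<x (All.lookup x<xs z∈))) (bound z (there z∈))
  w = proj₁ rec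
  u = List.take (c x) w
  v = List.drop (c x) w
  uv≡w : u ++ v ≡ w
  uv≡w = List.take++drop≡id (c x) w
  uv↭xs : u ++ v ↭ xs
  uv↭xs = subst (_↭ xs) (≡.sym uv≡w) (proj₁ (proj₂ rec))
  x<uv : All (x <_) (u ++ v)
  x<uv = All-resp-↭ (↭-sym uv↭xs) x<xs
  c≤ : c x ≤ length w
  c≤ = begin
    c x                                ≤⟨ bound x (here refl) ⟩
    length (filter (x <?_) (x ∷ xs))   ≡⟨ cong length (List.filter-reject (x <?_) (<-irrefl refl)) ⟩
    length (filter (x <?_) xs)         ≤⟨ List.length-filter (x <?_) xs ⟩
    length xs                          ≡⟨ ↭-length (proj₁ (proj₂ rec)) ⟨
    length w                           ∎
    where open ≤-Reasoning
  inv : ∀ y → y ∈ u ++ x ∷ v → #invBottom y (u ++ x ∷ v) ≡ c y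
  inv y y∈ with ∈-resp-↭ (shift x u v) y∈
  ... | here refl rewrite #invBottom-insert x x u v x<uv | ι-yes (x ≟ x) refl
                        | #invBottom-none x (u ++ v) (All.map (λ p e → <⇒≢ p (≡.sym e)) x<uv)
                        | List.length-take (c x) w | m≤n⇒m⊓n≡m c≤ = ≡.trans (+-identityʳ _) (+-identityʳ (c x))
  ... | there y∈uv rewrite #invBottom-insert y x u v x<uv | ι-no (x ≟ y) (<⇒≢ (All.lookup x<uv y∈uv)) | uv≡w =
    proj₂ (proj₂ rec) y y∈uv

arrangeTop : ∀ (c : ℕ → ℕ) xs → AllPairs _>_ xs →
             (∀ x → x ∈ xs → c x ≤ length (filter (_<? x) xs)) →
             ∃[ w ] w ↭ xs × (∀ x → x ∈ w → #invTop x w ≡ c x)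
arrangeTop c []       _            _     = [] , refl , λ _ ()
arrangeTop c (x ∷ xs) (x>xs ∷ xs↘) bound =
  u ++ x ∷ v , trans (shift x u v) (prep x uv↭xs) , inv
  where
  rec = arrangeTop c xs xs↘ λ z z∈ →
    subst (λ l → c z ≤ length l) (List.filter-reject (_<? z) (λ x<z → <-asym x<z (All.lookup x>xs z∈))) (bound z (there z∈))
  w = proj₁ rec
  u = List.take (length w ∸ c x) w
  v = List.drop (length w ∸ c x) w
  uv≡w : u ++ v ≡ w
  uv≡w = List.take++drop≡id (length w ∸ c x) w
  uv↭xs : u ++ v ↭ xs
  uv↭xs = subst (_↭ xs) (≡.sym uv≡w) (proj₁ (proj₂ rec))
  x>uv : All (_< x) (u ++ v)
  x>uv = All-resp-↭ (↭-sym uv↭xs) x>xs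
  c≤ : c x ≤ length w
  c≤ = begin
    c x                                ≤⟨ bound x (here refl) ⟩
    length (filter (_<? x) (x ∷ xs))   ≡⟨ cong length (List.filter-reject (_<? x) (<-irrefl refl)) ⟩
    length (filter (_<? x) xs)         ≤⟨ List.length-filter (_<? x) xs ⟩
    length xs                          ≡⟨ ↭-length (proj₁ (proj₂ rec)) ⟨
    length w                           ∎
    where open ≤-Reasoning
  inv : ∀ y → y ∈ u ++ x ∷ v → #invTop y (u ++ x ∷ v) ≡ c y
  inv y y∈ with ∈-resp-↭ (shift x u v) y∈
  ... | here refl rewrite #invTop-insert x x u v x>uv | ι-yes (x ≟ x) refl
                        | #invTop-none x (u ++ v) (All.map <⇒≢ x>uv)
                        | List.length-drop (length w ∸ c x) w | m∸[m∸n]≡n c≤ = ≡.trans (+-identityʳ _) (+-identityʳ (c x))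
  ... | there y∈uv rewrite #invTop-insert y x u v x>uv | ι-no (x ≟ y) (<⇒≢ (All.lookup x>uv y∈uv) ∘ ≡.sym) | uv≡w =
    proj₂ (proj₂ rec) y y∈uv

permute-columns : ∀ {bs cs : List ℕ} (as : List ℕ) → bs ↭ cs → length as ≡ length bs →
                  ∃[ as′ ] as′ ↭ as × zip as bs ↭ zip as′ cs
permute-columns as refl e = as , refl , refl
permute-columns (a ∷ as) (prep b p) e with permute-columns as p (suc-injective e)
... | as′ , q , r = a ∷ as′ , prep a q , prep (a , b) r
permute-columns (a₁ ∷ a₂ ∷ as) (swap b₁ b₂ p) e
  with permute-columns as p (suc-injective (suc-injective e))
... | as′ , q , r = a₂ ∷ a₁ ∷ as′ , swap a₂ a₁ q , swap (a₁ , b₁) (a₂ , b₂) r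
permute-columns as (trans p₁ p₂) e with permute-columns as p₁ e
... | as′ , q , r with permute-columns as′ p₂ (≡.trans (↭-length q) (≡.trans e (↭-length p₁)))
...   | as″ , q′ , r′ = as″ , trans q′ q , trans r r′

applyUpTo-lookup : ∀ (ts : List ℕ) {m} (e : length ts ≡ m) (f : ℕ → ℕ) →
                   (∀ i → f (toℕ i) ≡ lookup ts (cast (≡.sym e) i)) → applyUpTo f m ≡ ts
applyUpTo-lookup []       refl f h = refl
applyUpTo-lookup (t ∷ ts) refl f h =
  cong₂ _∷_ (h zero) (applyUpTo-lookup ts refl (f ∘ suc) (h ∘ suc))

zip-applyUpTo : ∀ (f g : ℕ → ℕ) m → zip (applyUpTo f m) (applyUpTo g m) ≡ applyUpTo (λ i → f i , g i) m
zip-applyUpTo f g zero    = refl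
zip-applyUpTo f g (suc m) = cong ((f 0 , g 0) ∷_) (zip-applyUpTo (f ∘ suc) (g ∘ suc) m)

word-permutation : ∀ {m} ts → ts ↭ [1… m ] →
                   ∃[ τ ] applyUpTo (λ i → _at_ {m} τ (suc i)) m ≡ ts
word-permutation {m} ts p = τ , applyUpTo-lookup ts e _ spec
  where
  e : length ts ≡ m
  e = ≡.trans (↭-length p) (List.length-applyUpTo suc m)
  ρ : Permutation (length ts) (length [1… m ])
  ρ = ↭ₛ.onIndices (↭⇒↭ₛ p)
  τ : Permutation′ m
  τ = cast-id (≡.sym e) ∘ₚ ρ ∘ₚ cast-id (List.length-applyUpTo suc m)
  spec : ∀ i → τ at suc (toℕ i) ≡ lookup ts (cast (≡.sym e) i)
  spec i = begin
    τ at suc (toℕ i)                                   ≡⟨ at-toℕ τ i ⟩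
    suc (toℕ (cast _ (ρ ⟨$⟩ʳ cast _ i)))               ≡⟨ cong suc (toℕ-cast _ (ρ ⟨$⟩ʳ cast _ i)) ⟩
    suc (toℕ (ρ ⟨$⟩ʳ cast (≡.sym e) i))                ≡⟨ List.lookup-applyUpTo suc m (ρ ⟨$⟩ʳ cast _ i) ⟨
    lookup [1… m ] (ρ ⟨$⟩ʳ cast (≡.sym e) i)           ≡⟨ ↭ₛ.onIndices-lookup (≡.setoid ℕ) (↭⇒↭ₛ p) (cast _ i) ⟨
    lookup ts (cast (≡.sym e) i)                       ∎
    where open ≡-Reasoning

biword-permutation : ∀ {m} as bs → as ↭ [1… m ] → bs ↭ [1… m ] →
                     ∃[ τ ] zip as bs ↭ applyUpTo (λ i → _at_ {m} τ (suc i) , suc i) m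
biword-permutation {m} as bs p q with permute-columns as q (≡.trans (↭-length p) (≡.sym (↭-length q)))
... | as′ , r , s with word-permutation as′ (trans r p)
...   | τ , e = τ , trans s (↭-reflexive
  (≡.trans (cong (λ ts → zip ts [1… m ]) (≡.sym e)) (zip-applyUpTo _ suc m)))

module _ {m} (σ : Permutation′ m) where

  Φ-exists : ∃ (IsΦ σ)
  Φ-exists = proj₁ biword , record
    { f′         = f′
    ; g′         = g′
    ; f′-letters = proj₁ (proj₂ top)
    ; g′-letters = g′↭
    ; f′-inv     = proj₂ (proj₂ top)
    ; g′-inv     = proj₂ (proj₂ non)
    ; columns    = proj₂ biword
    }
    where
    nonTop? = ¬? ∘ descentTop? σ

    top = arrangeBottom (pat2-31 σ) (descentTops σ)
      (AllPairs.filter⁺ (descentTop? σ) (AllPairs.applyUpTo⁺₁ suc m (λ i<j _ → s≤s i<j)))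
      (λ x _ → 2-31-bound-top σ x)

    nonDescentTops↘ : List ℕ
    nonDescentTops↘ = filter nonTop? (applyDownFrom suc m)

    ↘↭↗ : nonDescentTops↘ ↭ nonDescentTops σ
    ↘↭↗ = filter-↭ nonTop? (subst (_↭ [1… m ]) (List.reverse-applyUpTo suc m) (↭-reverse [1… m ]))

    non = arrangeTop (pat2-31 σ) nonDescentTops↘
      (AllPairs.filter⁺ nonTop? (AllPairs.applyDownFrom⁺₁ suc m (λ j<i _ → s≤s j<i)))
      λ x x∈ → let 1≤x , x≤m = letter-bounds (proj₁ (∈-filter⁻ nonTop? {xs = [1… m ]} (∈-resp-↭ ↘↭↗ x∈))) in
        subst (pat2-31 σ x ≤_) (≡.sym (↭-length (filter-↭ (_<? x) ↘↭↗))) (2-31-bound-nonTop σ x 1≤x x≤m)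

    f′ = proj₁ top
    g′ = proj₁ non
    g′↭ : g′ ↭ nonDescentTops σ
    g′↭ = trans (proj₁ (proj₂ non)) ↘↭↗

    biword = biword-permutation (descentBottoms σ ++ nonDescentBottoms σ) (f′ ++ g′)
      (filter-partition (descentBottom? σ) [1… m ])
      (trans (++⁺ (proj₁ (proj₂ top)) g′↭) (filter-partition (descentTop? σ) [1… m ]))

Φ : ∀ {m} → Permutation′ m → Permutation′ m
Φ σ = proj₁ (Φ-exists σ)

Φ-isΦ : ∀ {m} (σ : Permutation′ m) → IsΦ σ (Φ σ)
Φ-isΦ σ = proj₂ (Φ-exists σ)

-- hat σ is the word (σ(1)+1) … (σ(m)+1) 1.
hat : ∀ {m} → Permutation′ m → Permutation′ (suc m)
hat {m} σ = insert (fromℕ m) zero σ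

-- The letters τ(2), …, τ(m+1) of τ = Φ(hat σ); since τ(1) = m+1 is the largest
-- letter, removing it leaves the other letters unchanged (see Ψ-at).
Ψ : ∀ {m} → Permutation′ m → Permutation′ m
Ψ σ = remove zero (Φ (hat σ))

insert-self : ∀ {m n} i j (π : Permutation m n) → insert i j π ⟨$⟩ʳ i ≡ j
insert-self i j π with i Fin.≟ i
... | yes _  = refl
... | no i≢i = contradiction refl i≢i

punchIn-last : ∀ {m} (k : Fin m) → punchIn (fromℕ m) k ≡ inject₁ k
punchIn-last zero    = refl
punchIn-last (suc k) = cong suc (punchIn-last k)

hat-at : ∀ {m} (σ : Permutation′ m) j → 1 ≤ j → j ≤ m → hat σ at j ≡ suc (σ at j)
hat-at {m} σ j 1≤j j≤m with asFin 1≤j j≤m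
... | i , refl = begin
  hat σ at suc (toℕ i)                      ≡⟨ cong (λ k → hat σ at suc k) (toℕ-inject₁ i) ⟨
  hat σ at suc (toℕ (inject₁ i))            ≡⟨ at-toℕ (hat σ) (inject₁ i) ⟩
  suc (toℕ (hat σ ⟨$⟩ʳ inject₁ i))          ≡⟨ cong (λ k → suc (toℕ (hat σ ⟨$⟩ʳ k))) (punchIn-last i) ⟨
  suc (toℕ (hat σ ⟨$⟩ʳ punchIn (fromℕ m) i)) ≡⟨ cong (suc ∘ toℕ) (insert-punchIn (fromℕ m) zero σ i) ⟩
  suc (suc (toℕ (σ ⟨$⟩ʳ i)))                ≡⟨ cong suc (at-toℕ σ i) ⟨
  suc (σ at suc (toℕ i))                    ∎
  where open ≡-Reasoning

hat-last : ∀ {m} (σ : Permutation′ m) → hat σ at suc m ≡ 1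
hat-last {m} σ = begin
  hat σ at suc m                     ≡⟨ cong (λ k → hat σ at suc k) (toℕ-fromℕ m) ⟨
  hat σ at suc (toℕ (fromℕ m))       ≡⟨ at-toℕ (hat σ) (fromℕ m) ⟩
  suc (toℕ (hat σ ⟨$⟩ʳ fromℕ m))     ≡⟨ cong (suc ∘ toℕ) (insert-self (fromℕ m) zero σ) ⟩
  1                                  ∎
  where open ≡-Reasoning

zip-∷ʳ : ∀ (xs ys : List ℕ) a b → length xs ≡ length ys → (a , b) ∈ zip (xs ++ [ a ]) (ys ++ [ b ])
zip-∷ʳ []       []       a b e = here refl
zip-∷ʳ (x ∷ xs) (y ∷ ys) a b e = there (zip-∷ʳ xs ys a b (suc-injective e))

#invTop-last : ∀ w z → All (_≢ z) w → #invTop z (w ++ [ z ]) ≡ 0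
#invTop-last []      z []          = refl
#invTop-last (a ∷ w) z (a≢z ∷ w≢z) = ≡.trans (#invTop-∷ z a (w ++ [ z ]))
  (cong₂ _+_ (length-filter-none _ (All.universal (λ _ → λ { (_ , e) → a≢z e }) (w ++ [ z ]))) (#invTop-last w z w≢z))

module _ {m} (σ τ : Permutation′ m) (isΦ : IsΦ σ τ) (1≤m : 1 ≤ m) (last≡1 : σ at m ≡ 1) where
  open IsΦ isΦ

  private
    2-31-≥1 : ∀ z → z ≢ 1 → 1 ≤ z → z ≤ m → ¬ DescentTop σ z → 1 ≤ pat2-31 σ z
    2-31-≥1 z z≢1 1≤z z≤m ¬top = found (search (m ∸ suc k) (suc k) (m∸n+n≡m k<m) ≤-refl z<next)
      where
      k = pos σ z
      σk≡z : σ at k ≡ z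
      σk≡z = at-pos σ 1≤z z≤m
      k<m : k < m
      k<m = ≤∧≢⇒< (pos-≤ σ z) λ k≡m → z≢1 (≡.trans (≡.sym σk≡z) (≡.trans (cong (σ at_) k≡m) last≡1))
      later : ∀ {j} → k < j → σ at j ≢ z
      later {j} k<j e = <⇒≢ k<j (≡.trans (cong (pos σ) (≡.sym e)) (pos-unique σ j (subst (1 ≤_) (≡.sym e) 1≤z)))
      z<next : z < σ at suc k
      z<next = ≤∧≢⇒< (≮⇒≥ λ p → ¬top (k<m , p)) (later ≤-refl ∘ ≡.sym)

      search : ∀ d j → d + j ≡ m → k < j → z < σ at j → ∃[ i ] Is2-31 σ z i
      search zero j refl k<j z<σj = contradiction (subst (z <_) last≡1 z<σj) (≤⇒≯ 1≤z)
      search (suc d) j e k<j z<σj with <-cmp (σ at suc j) z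
      ... | tri< a _ _ = j , (k<j , subst (j <_) e (s≤s (m≤n+m j d))) , (a , z<σj)
      ... | tri≈ _ a _ = contradiction a (later (m<n⇒m<1+n k<j))
      ... | tri> _ _ a = search d (suc j) (≡.trans (+-suc d j) e) (m<n⇒m<1+n k<j) a

      found : (∃[ i ] Is2-31 σ z i) → 1 ≤ pat2-31 σ z
      found (suc i , h@((_ , i<m) , _)) = List.filter-some (is2-31? σ z) (Any.applyUpTo⁺ suc h (<⇒≤ i<m))

    nonDescentBottoms-last : ∃[ g₀ ] nonDescentBottoms σ ≡ g₀ ++ [ m ]
    nonDescentBottoms-last = filter P? (applyUpTo suc (pred m)) , (begin
      filter P? [1… m ]                              ≡⟨ cong (λ k → filter P? [1… k ]) m≡ ⟨
      filter P? [1… suc (pred m) ]                   ≡⟨ cong (filter P?) (List.applyUpTo-∷ʳ suc (pred m)) ⟨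
      filter P? ([1… pred m ] ++ [ suc (pred m) ])   ≡⟨ cong (λ k → filter P? ([1… pred m ] ++ [ k ])) m≡ ⟩
      filter P? ([1… pred m ] ++ [ m ])              ≡⟨ List.filter-++ P? [1… pred m ] [ m ] ⟩
      filter P? [1… pred m ] ++ filter P? [ m ]      ≡⟨ cong (filter P? [1… pred m ] ++_) (List.filter-accept P? {x = m} {xs = []} λ { (_ , q) → <⇒≱ q (at-≤ σ (pred (pos σ m))) }) ⟩
      filter P? [1… pred m ] ++ [ m ]                ∎)
      where
      open ≡-Reasoning
      P? = ¬? ∘ descentBottom? σ
      m≡ : suc (pred m) ≡ m
      m≡ = suc-pred m ⦃ >-nonZero 1≤m ⦄

    1∈nonDescentTops : 1 ∈ nonDescentTops σ
    1∈nonDescentTops = ∈-filter⁺ (¬? ∘ descentTop? σ) (∈-applyUpTo⁺ suc 1≤m)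
      λ { (p , _) → <⇒≢ p (≡.trans (cong (pos σ) (≡.sym last≡1)) (pos-at σ 1≤m ≤-refl)) }

    g′-unique : AllPairs _≢_ g′
    g′-unique = ↭ₛ.Unique-resp-↭ (≡.setoid ℕ) (↭⇒↭ₛ (↭-sym g′-letters))
      (AllPairs.filter⁺ (¬? ∘ descentTop? σ) (AllPairs.applyUpTo⁺₁ suc m (λ i<j _ → <⇒≢ (s≤s i<j))))

    g′-last : ∃[ g″ ] g′ ≡ g″ ++ [ 1 ]
    g′-last with List.initLast g′ | ∈-resp-↭ (↭-sym g′-letters) 1∈nonDescentTops | g′-unique | g′-inv | g′-letters
    ... | [] | () | _ | _ | _
    ... | g″ List.∷ʳ′ z | _ | unique | inv | letters with z ≟ 1
    ...   | yes refl = g″ , refl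
    ...   | no z≢1 = contradiction
      (≡.trans (≡.sym (inv z z∈)) (#invTop-last g″ z g″≢z))
      (λ e → <⇒≢ (2-31-≥1 z z≢1 1≤z z≤m (proj₂ z-nonTop)) (≡.sym e))
      where
      z∈ : z ∈ g″ ++ [ z ]
      z∈ = ∈-++⁺ʳ g″ (here refl)
      g″≢z : All (_≢ z) g″
      g″≢z with ↭ₛ.Unique-resp-↭ (≡.setoid ℕ) (↭⇒↭ₛ (shift z g″ [])) unique
      ... | z≢ ∷ _ = All.map (_∘ ≡.sym) (subst (All (z ≢_)) (List.++-identityʳ g″) z≢)
      z-nonTop : z ∈ [1… m ] × ¬ DescentTop σ z
      z-nonTop = ∈-filter⁻ (¬? ∘ descentTop? σ) {xs = [1… m ]} (∈-resp-↭ letters z∈)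
      1≤z = proj₁ (letter-bounds (proj₁ z-nonTop))
      z≤m = proj₂ (letter-bounds (proj₁ z-nonTop))

  Φ-first : τ at 1 ≡ m
  Φ-first with nonDescentBottoms-last | g′-last
  ... | g₀ , e₁ | g″ , e₂ = first (∈-applyUpTo⁻ _ (∈-resp-↭ columns column))
    where
    top : descentBottoms σ ++ nonDescentBottoms σ ≡ (descentBottoms σ ++ g₀) ++ [ m ]
    top = ≡.trans (cong (descentBottoms σ ++_) e₁) (≡.sym (List.++-assoc (descentBottoms σ) g₀ [ m ]))
    bottom : f′ ++ g′ ≡ (f′ ++ g″) ++ [ 1 ]
    bottom = ≡.trans (cong (f′ ++_) e₂) (≡.sym (List.++-assoc f′ g″ [ 1 ]))
    top↭bottom : descentBottoms σ ++ nonDescentBottoms σ ↭ f′ ++ g′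
    top↭bottom = trans (filter-partition (descentBottom? σ) [1… m ])
      (↭-sym (trans (++⁺ f′-letters g′-letters) (filter-partition (descentTop? σ) [1… m ])))
    lengths : length (descentBottoms σ ++ g₀) ≡ length (f′ ++ g″)
    lengths = +-cancelʳ-≡ 1 _ _ (≡.trans (≡.sym (List.length-++ (descentBottoms σ ++ g₀)))
      (≡.trans (cong length (≡.sym top)) (≡.trans (↭-length top↭bottom)
      (≡.trans (cong length bottom) (List.length-++ (f′ ++ g″))))))
    column : (m , 1) ∈ zip (descentBottoms σ ++ nonDescentBottoms σ) (f′ ++ g′)
    column rewrite top | bottom = zip-∷ʳ (descentBottoms σ ++ g₀) (f′ ++ g″) m 1 lengths
    first : (∃[ i ] i < m × (m , 1) ≡ (τ at suc i , suc i)) → τ at 1 ≡ m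
    first (i , _ , e) = ≡.trans (cong (λ k → τ at k) (cong proj₂ e)) (≡.sym (cong proj₁ e))

remove-first-at : ∀ {m} (τ : Permutation′ (suc m)) → τ at 1 ≡ suc m →
                  ∀ j → 1 ≤ j → j ≤ m → remove zero τ at j ≡ τ at suc j
remove-first-at {m} τ τ1≡ j 1≤j j≤m with asFin 1≤j j≤m
... | i , refl = begin
  τ′ at suc (toℕ i)                                ≡⟨ at-toℕ τ′ i ⟩
  suc (toℕ (τ′ ⟨$⟩ʳ i))                            ≡⟨ cong suc (toℕ-inject₁ _) ⟨
  suc (toℕ (inject₁ (τ′ ⟨$⟩ʳ i)))                  ≡⟨ cong (suc ∘ toℕ) (punchIn-last (τ′ ⟨$⟩ʳ i)) ⟨
  suc (toℕ (punchIn (fromℕ m) (τ′ ⟨$⟩ʳ i)))        ≡⟨ cong (λ k → suc (toℕ (punchIn k (τ′ ⟨$⟩ʳ i)))) τ0 ⟨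
  suc (toℕ (punchIn (τ ⟨$⟩ʳ zero) (τ′ ⟨$⟩ʳ i)))    ≡⟨ cong (suc ∘ toℕ) (punchIn-permute τ zero i) ⟨
  suc (toℕ (τ ⟨$⟩ʳ suc i))                         ≡⟨ at-toℕ τ (suc i) ⟨
  τ at suc (suc (toℕ i))                           ∎
  where
  open ≡-Reasoning
  τ′ = remove zero τ
  τ0 : τ ⟨$⟩ʳ zero ≡ fromℕ m
  τ0 = toℕ-injective (≡.trans (suc-injective (≡.trans (≡.sym (at-toℕ τ zero)) τ1≡)) (≡.sym (toℕ-fromℕ m)))

Φ-hat-first : ∀ {m} (σ : Permutation′ m) → Φ (hat σ) at 1 ≡ suc m
Φ-hat-first σ = Φ-first (hat σ) (Φ (hat σ)) (Φ-isΦ (hat σ)) (s≤s z≤n) (hat-last σ)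

Ψ-at : ∀ {m} (σ : Permutation′ m) j → 1 ≤ j → j ≤ m → Ψ σ at j ≡ Φ (hat σ) at suc j
Ψ-at σ = remove-first-at (Φ (hat σ)) (Φ-hat-first σ)

{-# OPTIONS --safe #-}
module Submission where

-- Write τ = Φ(σ), so that the columns of the biword are (τ(y) over y).  Since
-- its two upper words f and g are increasing, an inversion of f′ or g′ between
-- x and y compares τ(x) with τ(y), and the prescribed inversion numbers count
-- the nestings of τ.  At most as many 2-31 patterns sit at x as there are
-- descents from ≥ x to < x (strictly fewer if x is a descent top), and that
-- number of descents is the excess of descent bottoms < x over descent tops
-- < x.  Hence τ(x) < x exactly at the descent tops x.  Finally, Φ is applied to a
-- word ending in its smallest letter, which turns 2-31 into 2-13.

open import Defs
open import Data.Nat using (ℕ; suc)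
open import Data.Fin.Permutation using (Permutation′)
open import Relation.Binary.PropositionalEquality using (_≡_)

open import Algebra.Properties.CommutativeSemigroup using (interchange)
open import Data.Fin.Base using (toℕ)
open import Data.Fin.Properties using (toℕ<n)
open import Data.List.Base using (List; []; _∷_; _++_; length; map; filter; zip)
import Data.List.Properties as List
open import Data.List.Membership.Propositional using (_∈_)
open import Data.List.Membership.Propositional.Properties
  using (∈-filter⁺; ∈-filter⁻; ∈-applyUpTo⁺; ∈-applyUpTo⁻; ∈-map⁻)
open import Data.List.Relation.Binary.Permutation.Propositional using (_↭_; ↭-sym; trans)
open import Data.List.Relation.Binary.Permutation.Propositional.Properties
  using (filter-↭; ↭-length; ∈-resp-↭; ++⁺)
open import Data.List.Relation.Unary.All as All using (All; []; _∷_)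
open import Data.List.Relation.Unary.AllPairs as AllPairs using (AllPairs; []; _∷_)
import Data.List.Relation.Unary.AllPairs.Properties as AllPairs
open import Data.List.Relation.Unary.Any using (here; there)
open import Data.Nat.Base hiding (ℕ; suc)
open import Data.Nat.Properties
open import Data.Product.Base using (_×_; _,_; proj₁; proj₂)
open import Data.Sum.Base using (_⊎_; inj₁; inj₂)
open import Data.Vec.Properties using (tabulate-cong)
open import Function.Base using (_∘_; case_of_)
open import Relation.Binary.Definitions using (tri<; tri≈; tri>)
open import Relation.Binary.PropositionalEquality as ≡ using (_≢_; refl; cong; cong₂; subst; module ≡-Reasoning)
open import Relation.Nullary using (¬_; Dec; yes; no; contradiction)
open import Relation.Nullary.Decidable using (_×-dec_; _⊎-dec_; ¬?; dec-true; dec-false)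
open import Relation.Unary using (Decidable)

-- Counting letters with a given property.

ι-≤+ : ∀ {P Q R : Set} (d : Dec P) (e : Dec Q) (f : Dec R) → (P → Q ⊎ R) → ι d ≤ ι e + ι f
ι-≤+ (no _)  e f h = z≤n
ι-≤+ (yes p) e f h with h p
... | inj₁ q rewrite ι-yes e q = s≤s z≤n
... | inj₂ r rewrite ι-yes f r = m≤n+m 1 (ι e)

Σ-shift-both : ∀ m f → f 0 ≡ 0 → f m ≡ 0 → Σ< m (f ∘ suc) ≡ Σ< m f
Σ-shift-both m f f0≡0 fm≡0 = ≡.trans (Σ-shift m f f0≡0) (≡.trans (cong (Σ< m f +_) fm≡0) (+-identityʳ _))

module _ {P Q : ℕ → Set} (P? : Decidable P) (Q? : Decidable Q) where

  length-filter-cong : ∀ {xs} → All (λ x → (P x → Q x) × (Q x → P x)) xs →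
                       length (filter P? xs) ≡ length (filter Q? xs)
  length-filter-cong []                   = refl
  length-filter-cong {x ∷ xs} ((f , g) ∷ h)
    rewrite length-filter-∷ P? x xs | length-filter-∷ Q? x xs =
    cong₂ _+_ (ι-cong (P? x) (Q? x) f g) (length-filter-cong h)

  length-filter-∪ : ∀ {R : ℕ → Set} (R? : Decidable R) → (∀ x → P x → Q x ⊎ R x) → ∀ xs →
                    length (filter P? xs) ≤ length (filter Q? xs) + length (filter R? xs)
  length-filter-∪ R? h []       = z≤n
  length-filter-∪ R? h (x ∷ xs)
    rewrite length-filter-∷ P? x xs | length-filter-∷ Q? x xs | length-filter-∷ R? x xs =
    ≤-trans (+-mono-≤ (ι-≤+ (P? x) (Q? x) (R? x) (h x)) (length-filter-∪ R? h xs))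
            (≤-reflexive (interchange +-commutativeSemigroup (ι (Q? x)) (ι (R? x)) _ _))

  length-filter-mono : (∀ x → P x → Q x) → ∀ xs → length (filter P? xs) ≤ length (filter Q? xs)
  length-filter-mono h []       = z≤n
  length-filter-mono h (x ∷ xs)
    rewrite length-filter-∷ P? x xs | length-filter-∷ Q? x xs =
    +-mono-≤ (ι-mono (P? x) (Q? x) (h x)) (length-filter-mono h xs)

  length-filter-strict : (∀ x → P x → Q x) → ∀ {x xs} → x ∈ xs → Q x → ¬ P x →
                         length (filter P? xs) < length (filter Q? xs)
  length-filter-strict h {x} {_ ∷ xs} (here refl) q ¬p
    rewrite length-filter-∷ P? x xs | length-filter-∷ Q? x xs | ι-yes (Q? x) q | ι-no (P? x) ¬p =
    s≤s (length-filter-mono h xs)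
  length-filter-strict h {xs = y ∷ xs} (there x∈) q ¬p
    rewrite length-filter-∷ P? y xs | length-filter-∷ Q? y xs =
    +-mono-≤-< (ι-mono (P? y) (Q? y) (h y)) (length-filter-strict h x∈ q ¬p)

-- Serves to count the inversions between a first letter and a fixed later letter x: as x occurs
-- only once, there is at most one.
length-filter-once : ∀ {P : ℕ → Set} (P? : Decidable P) {x ys} → AllPairs _≢_ ys → x ∈ ys →
                     (∀ y → P y → y ≡ x) → length (filter P? ys) ≡ ι (P? x)
length-filter-once P? {x} {_ ∷ ys} (x≢ ∷ _) (here refl) h = ≡.trans (length-filter-∷ P? x ys)
  (≡.trans (cong (ι (P? x) +_) (length-filter-none P? (All.map (λ x≢z p → x≢z (≡.sym (h _ p))) x≢)))
           (+-identityʳ _))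
length-filter-once P? {x} {y ∷ ys} (y≢ ∷ u) (there x∈) h = ≡.trans (length-filter-∷ P? y ys)
  (cong₂ _+_ (ι-no (P? y) λ p → All.lookup y≢ x∈ (h y p)) (length-filter-once P? u x∈ h))

++-injective : ∀ {us vs xs ys : List ℕ} → length us ≡ length vs → us ++ xs ≡ vs ++ ys → us ≡ vs × xs ≡ ys
++-injective {[]}     {[]}     _ e = refl , e
++-injective {u ∷ us} {v ∷ vs} l e with List.∷-injective e
... | refl , e′ with ++-injective {us} {vs} (suc-injective l) e′
...   | refl , e″ = refl , e″

-- Turns the unordered information that every column of Φ(σ) has the form τ(y) over y into an
-- equality of words.
zip-graph : ∀ (h : ℕ → ℕ) xs ys → length xs ≡ length ys →
            (∀ {a b} → (a , b) ∈ zip xs ys → a ≡ h b) → xs ≡ map h ys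
zip-graph h []       []       _ _ = refl
zip-graph h (x ∷ xs) (y ∷ ys) e g =
  cong₂ _∷_ (g (here refl)) (zip-graph h xs ys (suc-injective e) (g ∘ there))

-- Inversions in a biword with increasing upper word.

-- A word w in which the letter y stands below h y, in columns sorted by h:
-- position in w is then compared through h.
module Biword (h : ℕ → ℕ) where

  Sorted : List ℕ → Set
  Sorted = AllPairs (λ y z → h y < h z)

  -- The letters y that form an inversion with x as bottom (for `invAbove?`, as top) in a sorted
  -- word: the order of positions is replaced by the order of the values of `h`.
  invBelow? : ∀ x y → Dec (h y < h x × x < y)
  invBelow? x y = (_ <? _) ×-dec (_ <? _)

  invAbove? : ∀ x y → Dec (h x < h y × y < x)
  invAbove? x y = (_ <? _) ×-dec (_ <? _)

  h-< : ∀ {y z} → h y < h z → y ≢ z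
  h-< p e = <⇒≢ p (cong h e)

  -- Induction on the word. If x comes first, nothing stands to its left, and `h` is smallest there;
  -- if another letter y comes first, then `h y < h x`, so y contributes one inversion exactly when
  -- `x < y`.
  #invBottom-sorted : ∀ {x w} → Sorted w → x ∈ w → #invBottom x w ≡ length (filter (invBelow? x) w)
  #invBottom-sorted {x} {_ ∷ w} (x<w ∷ _) (here refl) = ≡.trans
    (≡.trans (#invBottom-∷ x x w) (cong₂ _+_
      (length-filter-none _ (All.universal (λ b → λ { (b<x , b≡x) → <⇒≢ b<x b≡x }) w))
      (#invBottom-none x w (All.map (λ p → h-< p ∘ ≡.sym) x<w))))
    (≡.sym (length-filter-none (invBelow? x)
      ((λ { (p , _) → <-irrefl refl p }) ∷ All.map (λ p → λ { (q , _) → <-asym p q }) x<w)))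
  #invBottom-sorted {x} {y ∷ w} (y<w ∷ s) (there x∈) = ≡.trans (#invBottom-∷ x y w) (≡.trans
    (cong₂ _+_
      (≡.trans
        (length-filter-once (λ b → invBottom? x (y , b)) (AllPairs.map h-< s) x∈ (λ _ → proj₂))
        (ι-cong (invBottom? x (y , x)) (invBelow? x y)
          (λ { (p , _) → All.lookup y<w x∈ , p }) (λ { (_ , p) → p , refl })))
      (#invBottom-sorted s x∈))
    (≡.sym (length-filter-∷ (invBelow? x) y w)))

  -- If x comes first, all later letters have larger `h`, so its inversions are the smaller letters
  -- among them; a first letter other than x contributes to neither side.
  #invTop-sorted : ∀ {x w} → Sorted w → x ∈ w → #invTop x w ≡ length (filter (invAbove? x) w)
  #invTop-sorted {x} {_ ∷ w} (x<w ∷ _) (here refl) = ≡.trans (#invTop-∷ x x w) (≡.trans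
    (cong₂ _+_
      (length-filter-cong (λ b → invTop? x (x , b)) (invAbove? x)
        (All.map (λ p → (λ { (q , _) → p , q }) , (λ { (_ , q) → q , refl })) x<w))
      (#invTop-none x w (All.map (λ p → h-< p ∘ ≡.sym) x<w)))
    (≡.trans (+-comm _ 0) (≡.sym (≡.trans (length-filter-∷ (invAbove? x) x w)
      (cong (_+ length (filter (invAbove? x) w)) (ι-no (invAbove? x x) λ { (p , _) → <-irrefl refl p }))))))
  #invTop-sorted {x} {y ∷ w} (y<w ∷ s) (there x∈) = ≡.trans (#invTop-∷ x y w) (≡.trans
    (cong₂ _+_
      (≡.trans
        (length-filter-none (λ b → invTop? x (y , b))
          (All.universal (λ _ → λ { (_ , e) → h-< (All.lookup y<w x∈) e }) w))
        (≡.sym (ι-no (invAbove? x y) λ { (p , _) → <-asym p (All.lookup y<w x∈) })))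
      (#invTop-sorted s x∈))
    (≡.sym (length-filter-∷ (invAbove? x) y w)))

  below-map : ∀ x w → length (filter (_<? x) (map h w)) ≡ length (filter (λ y → h y <? x) w)
  below-map x w = length-filter-map (_<? x) h w

  module _ {x w} (sorted : Sorted w) (x∈w : x ∈ w) where

    -- By contraposition: if `x ≤ h x`, a column with upper letter below x has its lower letter
    -- below x too, or else a lower letter that forms an inversion with x as bottom. This bounds the
    -- number of upper letters below x.
    column-< : length (filter (_<? x) w) + #invBottom x w < length (filter (_<? x) (map h w)) → h x < x
    column-< lt = ≰⇒> λ x≤hx → <⇒≱ lt (begin
        length (filter (_<? x) (map h w))          ≡⟨ below-map x w ⟩
        length (filter (λ y → h y <? x) w)         ≤⟨ length-filter-∪ _ (_<? x) (invBelow? x) (split x≤hx) w ⟩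
        length (filter (_<? x) w) + length (filter (invBelow? x) w)
                                                   ≡⟨ cong (length (filter (_<? x) w) +_) (#invBottom-sorted sorted x∈w) ⟨
        length (filter (_<? x) w) + #invBottom x w ∎)
      where
      open ≤-Reasoning
      split : x ≤ h x → ∀ y → h y < x → y < x ⊎ (h y < h x × x < y)
      split x≤hx y hy<x with <-cmp y x
      ... | tri< y<x _ _ = inj₁ y<x
      ... | tri≈ _ refl _ = contradiction hy<x (≤⇒≯ x≤hx)
      ... | tri> _ _ x<y = inj₂ (<-≤-trans hy<x x≤hx , x<y)

    -- Dually, if `h x < x`, each lower letter `y ≤ x` stands under a letter below x, or forms an
    -- inversion with x as top. Since x itself is among these y, the count exceeds the number of
    -- letters below x by one, against the hypothesis.
    column-≥ : length (filter (_<? x) (map h w)) + #invTop x w ≤ length (filter (_<? x) w) → x ≤ h x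
    column-≥ le = ≮⇒≥ λ hx<x → <⇒≱ (begin-strict
        length (filter (_<? x) w)                  <⟨ length-filter-strict (_<? x) (_≤? x) (λ _ → <⇒≤) x∈w ≤-refl (<-irrefl refl) ⟩
        length (filter (_≤? x) w)                  ≤⟨ length-filter-∪ (_≤? x) _ (invAbove? x) (split hx<x) w ⟩
        length (filter (λ y → h y <? x) w) + length (filter (invAbove? x) w)
                                                   ≡⟨ cong₂ _+_ (below-map x w) (#invTop-sorted sorted x∈w) ⟨
        length (filter (_<? x) (map h w)) + #invTop x w ∎) le
      where
      open ≤-Reasoning
      split : h x < x → ∀ y → y ≤ x → h y < x ⊎ (h x < h y × y < x)
      split hx<x y y≤x with ≤-<-connex (h y) (h x)
      ... | inj₁ hy≤hx = inj₁ (≤-<-trans hy≤hx hx<x)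
      ... | inj₂ hx<hy = inj₂ (hx<hy , ≤∧≢⇒< y≤x (h-< hx<hy ∘ ≡.sym))

-- Descents across a level and occurrences of 2-31.

module _ {m} (σ : Permutation′ m) where

  downCrossing? : ∀ x k → Dec (1 ≤ k × x ≤ σ at k × σ at suc k < x)
  downCrossing? x k = (_ ≤? _) ×-dec (_ ≤? _) ×-dec (_ <? _)

  -- The range stops before `k = m`: the fall from the last letter to the conventional σ(m+1) = 0 is
  -- no descent.
  downCrossings : ℕ → ℕ
  downCrossings x = Σ< m (λ k → ι (downCrossing? x k))

  -- Match each descent bottom below x with the descent top just before it: that top is also below
  -- x, or the descent crosses the level x.
  descentBottoms-below : ∀ x → length (filter (_<? x) (descentBottoms σ)) ≡
                               length (filter (_<? x) (descentTops σ)) + downCrossings x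
  descentBottoms-below x = begin
    length (filter (_<? x) (descentBottoms σ))              ≡⟨ length-filter-filter (descentBottom? σ) (_<? x) [1… m ] ⟩
    count B? [1… m ]                                        ≡⟨ count-Σ B? m ⟩
    Σ< m (λ k → ι (B? (suc k)))                             ≡⟨ Σ-at σ (λ y → ι (B? y)) ⟨
    Σ< m (λ k → ι (B? (σ at suc k)))                        ≡⟨ Σ-cong m pointwise ⟨
    Σ< m (λ k → ι (T′? k) + ι (downCrossing? x k))          ≡⟨ Σ-+ m _ _ ⟩
    Σ< m (λ k → ι (T′? k)) + downCrossings x                ≡⟨ cong (_+ downCrossings x) tops ⟨
    length (filter (_<? x) (descentTops σ)) + downCrossings x ∎
    where
    open ≡-Reasoning
    B? : ∀ y → Dec (DescentBottom σ y × y < x)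
    B? y = descentBottom? σ y ×-dec (y <? x)
    T? : ∀ y → Dec (DescentTop σ y × y < x)
    T? y = descentTop? σ y ×-dec (y <? x)
    T′? : ∀ k → Dec (1 ≤ k × (k < m × σ at k > σ at suc k) × σ at k < x)
    T′? k = (_ ≤? _) ×-dec ((_ <? _) ×-dec (_ <? _)) ×-dec (_ <? _)

    tops : length (filter (_<? x) (descentTops σ)) ≡ Σ< m (λ k → ι (T′? k))
    tops = begin
      length (filter (_<? x) (descentTops σ))   ≡⟨ length-filter-filter (descentTop? σ) (_<? x) [1… m ] ⟩
      count T? [1… m ]                          ≡⟨ count-Σ T? m ⟩
      Σ< m (λ k → ι (T? (suc k)))               ≡⟨ Σ-at σ (λ y → ι (T? y)) ⟨
      Σ< m (λ k → ι (T? (σ at suc k)))          ≡⟨ Σ-cong m (λ k k<m → ι-cong (T? (σ at suc k)) (T′? (suc k))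
                                                     (λ { (t , l) → s≤s z≤n , subst (Top k) (p≡ k k<m) t , l })
                                                     (λ { (_ , t , l) → subst (Top k) (≡.sym (p≡ k k<m)) t , l })) ⟩
      -- The tops move to position k, facing the bottoms at k + 1; the end terms vanish, as position
      -- 0 holds no letter and position m no descent top.
      Σ< m (λ k → ι (T′? (suc k)))              ≡⟨ Σ-shift-both m (λ k → ι (T′? k)) (ι-no (T′? 0) λ { (() , _) })
                                                     (ι-no (T′? m) λ { (_ , (l , _) , _) → <-irrefl refl l }) ⟩
      Σ< m (λ k → ι (T′? k))                    ∎
      where
      Top : ℕ → ℕ → Set
      Top k j = j < m × σ at suc k > σ at suc j
      p≡ : ∀ k → k < m → pos σ (σ at suc k) ≡ suc k
      p≡ k k<m = pos-at σ (s≤s z≤n) k<m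

    pointwise : ∀ k → k < m → ι (T′? k) + ι (downCrossing? x k) ≡ ι (B? (σ at suc k))
    pointwise k k<m = ι-⊎ (T′? k) (downCrossing? x k) (B? (σ at suc k))
      (λ { (p , (_ , q) , r) → bottom (s≤s p , q) , <-trans q r })
      (λ { (p , q , r) → bottom (s≤s p , <-≤-trans r q) , r })
      (λ { (_ , _ , p) (_ , q , _) → <⇒≱ p q })
      (λ { (b , r) → let p , q = bottom⁻ b in case <-≤-connex (σ at k) x of λ where
             (inj₁ l) → inj₁ (s≤s⁻¹ p , (k<m , q) , l)
             (inj₂ l) → inj₂ (s≤s⁻¹ p , l , r) })
      where
      p≡ : pos σ (σ at suc k) ≡ suc k
      p≡ = pos-at σ (s≤s z≤n) k<m
      Bottom : ℕ → Set
      Bottom j = 1 < j × σ at pred j > σ at suc k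
      bottom : Bottom (suc k) → DescentBottom σ (σ at suc k)
      bottom = subst Bottom (≡.sym p≡)
      bottom⁻ : DescentBottom σ (σ at suc k) → Bottom (suc k)
      bottom⁻ = subst Bottom p≡

  -- Taking complements among the letters below x reverses the excess found in
  -- `descentBottoms-below`.
  nonDescentBottoms-below : ∀ x → length (filter (_<? x) (nonDescentBottoms σ)) + downCrossings x ≡
                                  length (filter (_<? x) (nonDescentTops σ))
  nonDescentBottoms-below x = +-cancelˡ-≡ T _ _ (begin
    T + (N + C)       ≡⟨ cong (T +_) (+-comm N C) ⟩
    T + (C + N)       ≡⟨ +-assoc T C N ⟨
    T + C + N         ≡⟨ cong (_+ N) (descentBottoms-below x) ⟨
    B + N             ≡⟨ partition (descentBottom? σ) ⟩
    length (filter (_<? x) [1… m ]) ≡⟨ partition (descentTop? σ) ⟨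
    T + length (filter (_<? x) (nonDescentTops σ)) ∎)
    where
    open ≡-Reasoning
    T = length (filter (_<? x) (descentTops σ))
    B = length (filter (_<? x) (descentBottoms σ))
    N = length (filter (_<? x) (nonDescentBottoms σ))
    C = downCrossings x
    partition : ∀ {P : ℕ → Set} (P? : Decidable P) →
                length (filter (_<? x) (filter P? [1… m ])) + length (filter (_<? x) (filter (¬? ∘ P?) [1… m ]))
                ≡ length (filter (_<? x) [1… m ])
    partition P? = ≡.trans (≡.sym (List.length-++ (filter (_<? x) (filter P? [1… m ]))))
      (≡.trans (cong length (≡.sym (List.filter-++ (_<? x) (filter P? [1… m ]) (filter (¬? ∘ P?) [1… m ]))))
               (↭-length (filter-↭ (_<? x) (filter-partition P? [1… m ]))))

  -- This is `descentBottoms-below` at the level `suc m`, which lies above all letters and is never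
  -- crossed.
  length-descentBottoms : length (descentBottoms σ) ≡ length (descentTops σ)
  length-descentBottoms = begin
    length (descentBottoms σ)                                       ≡⟨ all (descentBottom? σ) ⟨
    length (filter (_<? suc m) (descentBottoms σ))                  ≡⟨ descentBottoms-below (suc m) ⟩
    length (filter (_<? suc m) (descentTops σ)) + downCrossings (suc m)
      ≡⟨ cong₂ _+_ (all (descentTop? σ)) (Σ-zero m λ k _ → ι-no (downCrossing? (suc m) k) λ { (_ , p , _) → <⇒≱ p (at-≤ σ k) }) ⟩
    length (descentTops σ) + 0                                      ≡⟨ +-identityʳ _ ⟩
    length (descentTops σ)                                          ∎
    where
    open ≡-Reasoning
    all : ∀ {P : ℕ → Set} (P? : Decidable P) →
          length (filter (_<? suc m) (filter P? [1… m ])) ≡ length (filter P? [1… m ])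
    all P? = cong length (List.filter-all (_<? suc m)
      (All.tabulate λ x∈ → s≤s (proj₂ (letter-bounds (proj₁ (∈-filter⁻ P? {xs = [1… m ]} x∈))))))

  pat2-31-Σ : ∀ x → pat2-31 σ x ≡ Σ< m (λ k → ι (is2-31? σ x k))
  pat2-31-Σ x = ≡.trans (count-Σ (is2-31? σ x) m) (Σ-shift-both m (λ k → ι (is2-31? σ x k))
    (ι-no (is2-31? σ x 0) λ { ((() , _) , _) })
    (ι-no (is2-31? σ x m) λ { ((_ , p) , _) → <-irrefl refl p }))

  2-31⇒downCrossing : ∀ x k → Is2-31 σ x k → 1 ≤ k × x ≤ σ at k × σ at suc k < x
  2-31⇒downCrossing x k ((p , _) , q , r) = ≤-trans (s≤s z≤n) p , <⇒≤ r , q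

  pat2-31-≤ : ∀ x → pat2-31 σ x ≤ downCrossings x
  pat2-31-≤ x = subst (_≤ downCrossings x) (≡.sym (pat2-31-Σ x))
    (Σ-mono m λ k _ → ι-mono (is2-31? σ x k) (downCrossing? x k) (2-31⇒downCrossing x k))

  -- The descent that starts at x itself crosses the level x, but is no occurrence of 2-31, whose
  -- descent lies strictly to the right of x.
  pat2-31-< : ∀ {x} → 1 ≤ x → x ≤ m → DescentTop σ x → pat2-31 σ x < downCrossings x
  pat2-31-< {x} 1≤x x≤m (K<m , down) = begin-strict
    pat2-31 σ x                                              ≡⟨ pat2-31-Σ x ⟩
    Σ< m (λ k → ι (is2-31? σ x k))                           <⟨ m<m+n _ ≤-refl ⟩
    Σ< m (λ k → ι (is2-31? σ x k)) + 1                       ≡⟨ cong (Σ< m (λ k → ι (is2-31? σ x k)) +_) single ⟨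
    Σ< m (λ k → ι (is2-31? σ x k)) + Σ< m (λ k → ι (k ≟ K))  ≡⟨ Σ-+ m _ _ ⟨
    Σ< m (λ k → ι (is2-31? σ x k) + ι (k ≟ K))               ≤⟨ Σ-mono m (λ k _ → ι-+≤ (is2-31? σ x k) (k ≟ K) (downCrossing? x k)
                                                                  (2-31⇒downCrossing x k)
                                                                  (λ { refl → pos-≥1 σ 1≤x x≤m , ≤-reflexive (≡.sym (at-pos σ 1≤x x≤m)) , down })
                                                                  (λ { ((p , _) , _) e → <⇒≢ p (≡.sym e) })) ⟩
    downCrossings x                                          ∎
    where
    open ≤-Reasoning
    K = pos σ x
    single : Σ< m (λ k → ι (k ≟ K)) ≡ 1
    single = ≡.trans (Σ-single m K K<m (λ j _ → ι-no (j ≟ K))) (ι-yes (K ≟ K) refl)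

-- Descents of σ as exceedances of Φ(σ), and 2-31 patterns as nestings.

module _ {m} {σ τ : Permutation′ m} (isΦ : IsΦ σ τ) where
  open IsΦ isΦ
  open Biword (τ at_)

  private
    f g : List ℕ
    f = descentBottoms σ
    g = nonDescentBottoms σ

    f++g↭ : f ++ g ↭ [1… m ]
    f++g↭ = filter-partition (descentBottom? σ) [1… m ]

    f′++g′↭ : f′ ++ g′ ↭ [1… m ]
    f′++g′↭ = trans (++⁺ f′-letters g′-letters) (filter-partition (descentTop? σ) [1… m ])

    column : ∀ {a b} → (a , b) ∈ zip (f ++ g) (f′ ++ g′) → a ≡ τ at b
    column ab∈ with ∈-applyUpTo⁻ _ (∈-resp-↭ columns ab∈)
    ... | i , _ , refl = refl

    -- The columns give the equality for the concatenated words; as there are as many descent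
    -- bottoms as descent tops, both sides split at the same place.
    f≡,g≡ : f ≡ map (τ at_) f′ × g ≡ map (τ at_) g′
    f≡,g≡ = ++-injective
      (≡.trans (length-descentBottoms σ) (≡.trans (≡.sym (↭-length f′-letters)) (≡.sym (List.length-map (τ at_) f′))))
      (≡.trans (zip-graph (τ at_) (f ++ g) (f′ ++ g′) (≡.trans (↭-length f++g↭) (≡.sym (↭-length f′++g′↭))) column)
               (List.map-++ (τ at_) f′ g′))

    f≡ = proj₁ f≡,g≡
    g≡ = proj₂ f≡,g≡

    sorted : ∀ {P : ℕ → Set} (P? : Decidable P) {w} → filter P? [1… m ] ≡ map (τ at_) w → Sorted w
    sorted P? e = AllPairs.map⁻ (subst (AllPairs _<_) e
      (AllPairs.filter⁺ P? (AllPairs.applyUpTo⁺₁ suc m (λ i<j _ → s≤s i<j))))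

    f′-sorted : Sorted f′
    f′-sorted = sorted (descentBottom? σ) f≡

    g′-sorted : Sorted g′
    g′-sorted = sorted (¬? ∘ descentBottom? σ) g≡

    letter∈ : ∀ {x} → 1 ≤ x → x ≤ m → x ∈ [1… m ]
    letter∈ {suc x} _ x<m = ∈-applyUpTo⁺ suc x<m

    ∈f′ : ∀ {x} → 1 ≤ x → x ≤ m → DescentTop σ x → x ∈ f′
    ∈f′ 1≤x x≤m t = ∈-resp-↭ (↭-sym f′-letters) (∈-filter⁺ (descentTop? σ) (letter∈ 1≤x x≤m) t)

    ∈g′ : ∀ {x} → 1 ≤ x → x ≤ m → ¬ DescentTop σ x → x ∈ g′
    ∈g′ 1≤x x≤m t = ∈-resp-↭ (↭-sym g′-letters) (∈-filter⁺ (¬? ∘ descentTop? σ) (letter∈ 1≤x x≤m) t)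

    below-↭ : ∀ x {v w : List ℕ} → v ↭ w → length (filter (_<? x) v) ≡ length (filter (_<? x) w)
    below-↭ x p = ↭-length (filter-↭ (_<? x) p)

  -- The word f has `downCrossings σ x` more letters below x than f′, while strictly fewer
  -- inversions of f′ have x as bottom.
  Φ-descentTop : ∀ {x} → 1 ≤ x → x ≤ m → DescentTop σ x → τ at x < x
  Φ-descentTop {x} 1≤x x≤m t = column-< f′-sorted x∈ (begin-strict
    length (filter (_<? x) f′) + #invBottom x f′               ≡⟨ cong₂ _+_ (below-↭ x f′-letters) (f′-inv x x∈) ⟩
    length (filter (_<? x) (descentTops σ)) + pat2-31 σ x      <⟨ +-monoʳ-< _ (pat2-31-< σ 1≤x x≤m t) ⟩
    length (filter (_<? x) (descentTops σ)) + downCrossings σ x ≡⟨ descentBottoms-below σ x ⟨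
    length (filter (_<? x) f)                                  ≡⟨ cong (length ∘ filter (_<? x)) f≡ ⟩
    length (filter (_<? x) (map (τ at_) f′))                   ∎)
    where
    open ≤-Reasoning
    x∈ = ∈f′ 1≤x x≤m t

  -- The word g has `downCrossings σ x` fewer letters below x than g′, and at most that many
  -- inversions of g′ have x as top.
  Φ-nonDescentTop : ∀ {x} → 1 ≤ x → x ≤ m → ¬ DescentTop σ x → x ≤ τ at x
  Φ-nonDescentTop {x} 1≤x x≤m t = column-≥ g′-sorted x∈ (begin
    length (filter (_<? x) (map (τ at_) g′)) + #invTop x g′ ≡⟨ cong₂ _+_ (cong (length ∘ filter (_<? x)) (≡.sym g≡)) (g′-inv x x∈) ⟩
    length (filter (_<? x) g) + pat2-31 σ x                 ≤⟨ +-monoʳ-≤ (length (filter (_<? x) g)) (pat2-31-≤ σ x) ⟩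
    length (filter (_<? x) g) + downCrossings σ x           ≡⟨ nonDescentBottoms-below σ x ⟩
    length (filter (_<? x) (nonDescentTops σ))              ≡⟨ below-↭ x g′-letters ⟨
    length (filter (_<? x) g′)                              ∎)
    where
    open ≤-Reasoning
    x∈ = ∈g′ 1≤x x≤m t

  -- A descent bottom x lies in f, so the letter y under it, which is τ⁻¹(x), lies in f′ and is a
  -- descent top; `Φ-descentTop` applies to y.
  Φ-descentBottom : ∀ {x} → 1 ≤ x → x ≤ m → DescentBottom σ x → x < pos τ x
  Φ-descentBottom {x} 1≤x x≤m b
    with ∈-map⁻ (τ at_) (subst (x ∈_) f≡ (∈-filter⁺ (descentBottom? σ) (letter∈ 1≤x x≤m) b))
  ... | y , y∈ , refl with ∈-filter⁻ (descentTop? σ) {xs = [1… m ]} (∈-resp-↭ f′-letters y∈)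
  ...   | y∈m , t with letter-bounds y∈m
  ...     | 1≤y , y≤m = subst (x <_) (≡.sym (pos-at τ 1≤y y≤m)) (Φ-descentTop 1≤y y≤m t)

  Φ-nonDescentBottom : ∀ {x} → 1 ≤ x → x ≤ m → ¬ DescentBottom σ x → pos τ x ≤ x
  Φ-nonDescentBottom {x} 1≤x x≤m b
    with ∈-map⁻ (τ at_) (subst (x ∈_) g≡ (∈-filter⁺ (¬? ∘ descentBottom? σ) (letter∈ 1≤x x≤m) b))
  ... | y , y∈ , refl with ∈-filter⁻ (¬? ∘ descentTop? σ) {xs = [1… m ]} (∈-resp-↭ g′-letters y∈)
  ...   | y∈m , t with letter-bounds y∈m
  ...     | 1≤y , y≤m = subst (_≤ x) (≡.sym (pos-at τ 1≤y y≤m)) (Φ-nonDescentTop 1≤y y≤m t)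

  -- The inversions of f′ involve only descent tops, but this is automatic: τ(y) < τ(x) < x < y
  -- gives τ(y) < y, which only descent tops satisfy.
  pat2-31-descentTop : ∀ {x} → 1 ≤ x → x ≤ m → DescentTop σ x →
                       pat2-31 σ x ≡ count (invBelow? x) [1… m ]
  pat2-31-descentTop {x} 1≤x x≤m t = begin
    pat2-31 σ x                                   ≡⟨ f′-inv x x∈ ⟨
    #invBottom x f′                               ≡⟨ #invBottom-sorted f′-sorted x∈ ⟩
    length (filter (invBelow? x) f′)              ≡⟨ ↭-length (filter-↭ (invBelow? x) f′-letters) ⟩
    length (filter (invBelow? x) (descentTops σ)) ≡⟨ length-filter-filter (descentTop? σ) (invBelow? x) [1… m ] ⟩
    count (λ y → descentTop? σ y ×-dec invBelow? x y) [1… m ]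
      ≡⟨ length-filter-cong _ (invBelow? x) (All.tabulate λ y∈ → let 1≤y , y≤m = letter-bounds y∈ in proj₂ , λ (p , q) →
           (case descentTop? σ _ of λ where
             (yes d) → d
             (no ¬d) → contradiction (≤-trans (Φ-nonDescentTop 1≤y y≤m ¬d) (<⇒≤ p))
                         (<⇒≱ (<-trans (Φ-descentTop 1≤x x≤m t) q))) , p , q) ⟩
    count (invBelow? x) [1… m ]                   ∎
    where
    open ≡-Reasoning
    x∈ = ∈f′ 1≤x x≤m t

  -- Likewise y < x ≤ τ(x) < τ(y) forces y to be no descent top, so counting over all letters adds
  -- nothing to the inversions of g′.
  pat2-31-nonDescentTop : ∀ {x} → 1 ≤ x → x ≤ m → ¬ DescentTop σ x →
                          pat2-31 σ x ≡ count (invAbove? x) [1… m ]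
  pat2-31-nonDescentTop {x} 1≤x x≤m t = begin
    pat2-31 σ x                                      ≡⟨ g′-inv x x∈ ⟨
    #invTop x g′                                     ≡⟨ #invTop-sorted g′-sorted x∈ ⟩
    length (filter (invAbove? x) g′)                 ≡⟨ ↭-length (filter-↭ (invAbove? x) g′-letters) ⟩
    length (filter (invAbove? x) (nonDescentTops σ)) ≡⟨ length-filter-filter (¬? ∘ descentTop? σ) (invAbove? x) [1… m ] ⟩
    count (λ y → ¬? (descentTop? σ y) ×-dec invAbove? x y) [1… m ]
      ≡⟨ length-filter-cong _ (invAbove? x) (All.tabulate λ y∈ → let 1≤y , y≤m = letter-bounds y∈ in proj₂ , λ (p , q) →
           (λ d → <⇒≱ (<-trans (<-trans p (Φ-descentTop 1≤y y≤m d)) q) (Φ-nonDescentTop 1≤x x≤m t)) , p , q) ⟩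
    count (invAbove? x) [1… m ]                      ∎
    where
    open ≡-Reasoning
    x∈ = ∈g′ 1≤x x≤m t

-- From σ to the word `hat σ`.

module _ {m} (σ : Permutation′ m) where

  -- The final 1 of `hat σ` is the convention σ(m+1) = 0 raised by one, so the formula extends to
  -- the last position.
  hat-at-≤ : ∀ j → 1 ≤ j → j ≤ suc m → hat σ at j ≡ suc (σ at j)
  hat-at-≤ j 1≤j j≤1+m with m≤n⇒m<n∨m≡n j≤1+m
  ... | inj₁ j≤m  = hat-at σ j 1≤j (s≤s⁻¹ j≤m)
  ... | inj₂ refl = ≡.trans (hat-last σ) (cong suc (≡.sym (at-beyond σ (suc m) ≤-refl)))

  module _ {i} (1≤i : 1 ≤ i) (i≤m : i ≤ m) where
    private
      K = pos σ i
      1≤K : 1 ≤ K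
      1≤K = pos-≥1 σ 1≤i i≤m
      K≤m : K ≤ m
      K≤m = pos-≤ σ i
      hat-next : hat σ at suc K ≡ suc (σ at suc K)
      hat-next = hat-at-≤ (suc K) (s≤s z≤n) (s≤s K≤m)

    pos-hat : pos (hat σ) (suc i) ≡ K
    pos-hat = begin
      pos (hat σ) (suc i)           ≡⟨ cong (pos (hat σ) ∘ suc) (at-pos σ 1≤i i≤m) ⟨
      pos (hat σ) (suc (σ at K))    ≡⟨ cong (pos (hat σ)) (hat-at σ K 1≤K K≤m) ⟨
      pos (hat σ) (hat σ at K)      ≡⟨ pos-at (hat σ) 1≤K (m≤n⇒m≤1+n K≤m) ⟩
      K                             ∎
      where open ≡-Reasoning

    -- This includes the case where i is the last letter of σ: its fall to the conventional 0
    -- becomes a genuine descent to the letter 1.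
    hat-descentTop : σ at suc K < i → DescentTop (hat σ) (suc i)
    hat-descentTop down = subst (λ j → j < suc m × suc i > hat σ at suc j) (≡.sym pos-hat)
      (s≤s K≤m , subst (suc i >_) (≡.sym hat-next) (s≤s down))

    hat-nonDescentTop : i < σ at suc K → ¬ DescentTop (hat σ) (suc i)
    hat-nonDescentTop up (_ , down) = <-asym up (s≤s⁻¹ (subst (suc i >_) hat-next
      (subst (λ j → suc i > hat σ at suc j) pos-hat down)))

    hat-pred : ∀ {k} → suc k ≡ K → 1 ≤ k → hat σ at k ≡ suc (σ at k)
    hat-pred {k} e 1≤k = hat-at-≤ k 1≤k (m≤n⇒m≤1+n (≤-trans (n≤1+n k) (≤-trans (≤-reflexive e) K≤m)))

    hat-descentBottom : i < σ at pred K → DescentBottom (hat σ) (suc i)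
    hat-descentBottom down = subst (λ j → 1 < j × hat σ at pred j > suc i) (≡.sym pos-hat)
      (go (pred K) (suc-pred-pos σ 1≤i i≤m) down)
      where
      -- The case `k = 0` is absurd, since `σ at 0` is 0: a left neighbour larger than i is a
      -- genuine letter.
      go : ∀ k → suc k ≡ K → i < σ at k → 1 < K × hat σ at pred K > suc i
      go (suc k) e down rewrite ≡.sym e | hat-pred e (s≤s z≤n) = s≤s (s≤s z≤n) , s≤s down

    hat-nonDescentBottom : σ at pred K < i → ¬ DescentBottom (hat σ) (suc i)
    hat-nonDescentBottom up b with subst (λ j → 1 < j × hat σ at pred j > suc i) pos-hat b
    ... | 1<K , down = <-asym up (s≤s⁻¹ (subst (suc i <_)
      (hat-pred (suc-pred-pos σ 1≤i i≤m) (pred-mono-≤ 1<K)) down))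

    -- To the right of i the word crosses the level i alternately downwards
    -- (occurrences of 2-31) and upwards (2-13), and it ends below i.
    pat2-31-hat : pat2-31 (hat σ) (suc i) ≡ pat2-13 σ i + ι (i <? σ at suc K)
    pat2-31-hat = begin
      pat2-31 (hat σ) (suc i)                    ≡⟨ pat2-31-Σ (hat σ) (suc i) ⟩
      Σ< (suc m) down                            ≡⟨ +-identityʳ _ ⟨
      Σ< (suc m) down + 0                        ≡⟨ cong (Σ< (suc m) down +_) (ι-no (i <? σ at suc m) λ p → n≮0 (subst (i <_) (at-beyond σ (suc m) ≤-refl) p)) ⟨
      Σ< (suc m) down + above (suc m)            ≡⟨ subst (λ z → Σ< z down + above z ≡ Σ< z up + above (suc K)) (m∸n+n≡m (s≤s K≤m)) (alternate (m ∸ K) (≤-reflexive (m∸n+n≡m (s≤s K≤m)))) ⟩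
      Σ< (suc m) up + above (suc K)              ≡⟨ cong (_+ above (suc K)) ups ⟨
      pat2-13 σ i + above (suc K)                ∎
      where
      open ≡-Reasoning
      down up above : ℕ → ℕ
      down k = ι (is2-31? (hat σ) (suc i) k)
      up k = ι (is2-13? σ i k)
      above k = ι (i <? σ at k)

      down? : ∀ k → Dec (σ at suc k < i × i < σ at k)
      down? k = (_ <? _) ×-dec (_ <? _)
      up? : ∀ k → Dec (σ at k < i × i < σ at suc k)
      up? k = (_ <? _) ×-dec (_ <? _)
      cross? : ∀ k → Dec (i < σ at k ⊎ i < σ at suc k)
      cross? k = (_ <? _) ⊎-dec (_ <? _)

      ups : pat2-13 σ i ≡ Σ< (suc m) up
      ups = ≡.trans (count-Σ (is2-13? σ i) m) (Σ-shift m up (ι-no (is2-13? σ i 0) λ { ((() , _) , _) }))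

      ≢i : ∀ {k} → K < k → σ at k ≢ i
      ≢i K<k e = <⇒≢ K<k (≡.trans (cong (pos σ) (≡.sym e)) (pos-unique σ _ (subst (1 ≤_) (≡.sym e) 1≤i)))

      -- Both sides indicate that σ(k) or σ(k+1) exceeds i. Past K the letter i does not recur, so
      -- if just one of the two exceeds i, the other is strictly below.
      step : ∀ k → K < k → k ≤ m → down k + above (suc k) ≡ up k + above k
      step k K<k k≤m = begin
        down k + above (suc k)             ≡⟨ cong (_+ above (suc k)) (ι-cong (is2-31? (hat σ) (suc i) k) (down? k)
                                                (λ { (_ , p , q) → s≤s⁻¹ (subst (_< suc i) hat-k+1 p) , s≤s⁻¹ (subst (suc i <_) hat-k q) })
                                                (λ { (p , q) → (subst (_< k) (≡.sym pos-hat) K<k , s≤s k≤m) ,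
                                                       subst (_< suc i) (≡.sym hat-k+1) (s≤s p) , subst (suc i <_) (≡.sym hat-k) (s≤s q) })) ⟩
        ι (down? k) + above (suc k)        ≡⟨ ι-⊎ (down? k) (i <? σ at suc k) (cross? k) (inj₁ ∘ proj₂) inj₂
                                                (λ { (p , _) q → <-asym p q })
                                                (λ { (inj₂ q) → inj₂ q
                                                   ; (inj₁ p) → case <-≤-connex i (σ at suc k) of λ where
                                                       (inj₁ q) → inj₂ q
                                                       (inj₂ q) → inj₁ (≤∧≢⇒< q (≢i (m<n⇒m<1+n K<k)) , p) }) ⟩
        ι (cross? k)                       ≡⟨ ι-⊎ (up? k) (i <? σ at k) (cross? k) (inj₂ ∘ proj₂) inj₁
                                                (λ { (p , _) q → <-asym p q })
                                                (λ { (inj₁ q) → inj₂ q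
                                                   ; (inj₂ p) → case <-≤-connex i (σ at k) of λ where
                                                       (inj₁ q) → inj₂ q
                                                       (inj₂ q) → inj₁ (≤∧≢⇒< q (≢i K<k) , p) }) ⟨
        ι (up? k) + above k                ≡⟨ cong (_+ above k) (ι-cong (up? k) (is2-13? σ i k)
                                                -- Here `k = m` is excluded because σ(m+1) = 0
                                                -- cannot exceed i.
                                                (λ { (p , q) → (K<k , ≤∧≢⇒< k≤m (λ { refl → n≮0 (subst (i <_) (at-beyond σ (suc m) ≤-refl) q) })) , p , q })
                                                proj₂) ⟩
        up k + above k                     ∎
        where
        hat-k : hat σ at k ≡ suc (σ at k)
        hat-k = hat-at-≤ k (≤-trans (s≤s z≤n) K<k) (m≤n⇒m≤1+n k≤m)
        hat-k+1 : hat σ at suc k ≡ suc (σ at suc k)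
        hat-k+1 = hat-at-≤ (suc k) (s≤s z≤n) (s≤s k≤m)

      -- Telescopes `step` from position `suc K` on; up to K neither pattern occurs.
      alternate : ∀ d → d + suc K ≤ suc m → Σ< (d + suc K) down + above (d + suc K) ≡ Σ< (d + suc K) up + above (suc K)
      alternate zero _ = cong (_+ above (suc K)) (≡.trans
        (Σ-zero (suc K) λ k k≤K → ι-no (is2-31? (hat σ) (suc i) k) λ { ((p , _) , _) → <⇒≱ (subst (_< k) pos-hat p) (s≤s⁻¹ k≤K) })
        (≡.sym (Σ-zero (suc K) λ k k≤K → ι-no (is2-13? σ i k) λ { ((p , _) , _) → <⇒≱ p (s≤s⁻¹ k≤K) })))
      alternate (suc d) le = begin
        Σ< k down + down k + above (suc k)   ≡⟨ +-assoc (Σ< k down) (down k) _ ⟩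
        Σ< k down + (down k + above (suc k)) ≡⟨ cong (Σ< k down +_) (step k (m≤n+m (suc K) d) (s≤s⁻¹ le)) ⟩
        Σ< k down + (up k + above k)         ≡⟨ cong (Σ< k down +_) (+-comm (up k) (above k)) ⟩
        Σ< k down + (above k + up k)         ≡⟨ +-assoc (Σ< k down) (above k) (up k) ⟨
        Σ< k down + above k + up k           ≡⟨ cong (_+ up k) (alternate d (<⇒≤ le)) ⟩
        Σ< k up + above (suc K) + up k       ≡⟨ +-assoc (Σ< k up) (above (suc K)) (up k) ⟩
        Σ< k up + (above (suc K) + up k)     ≡⟨ cong (Σ< k up +_) (+-comm (above (suc K)) (up k)) ⟩
        Σ< k up + (up k + above (suc K))     ≡⟨ +-assoc (Σ< k up) (up k) _ ⟨
        Σ< k up + up k + above (suc K)       ∎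
        where k = d + suc K

-- The four kinds of steps in the two paths.

module _ {m} (σ : Permutation′ m) (i : ℕ) where
  private
    K = pos σ i

  stepFV-U : Valley σ K → stepFV σ i ≡ U
  stepFV-U v rewrite dec-true (valley? σ K) v = refl

  stepFV-D : Peak σ K → stepFV σ i ≡ D
  stepFV-D p@(l , _)
    rewrite dec-false (valley? σ K) (λ { (q , _) → <-asym l q }) | dec-true (peak? σ K) p = refl

  stepFV-Lb : DoubleAscent σ K → stepFV σ i ≡ Lb
  stepFV-Lb a@(l , r)
    rewrite dec-false (valley? σ K) (λ { (q , _) → <-asym l q })
          | dec-false (peak? σ K) (λ { (_ , q) → <-asym r q })
          | dec-true (doubleAscent? σ K) a = refl

  stepFV-Lᵣ : σ at pred K > σ at K × σ at K > σ at suc K → stepFV σ i ≡ Lᵣ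
  stepFV-Lᵣ (l , r)
    rewrite dec-false (valley? σ K) (λ { (_ , q) → <-asym r q })
          | dec-false (peak? σ K) (λ { (q , _) → <-asym l q })
          | dec-false (doubleAscent? σ K) (λ { (q , _) → <-asym l q }) = refl

  stepYZL-U : i < σ at i → suc i ≤ pos σ (suc i) → stepYZL σ i ≡ U
  stepYZL-U a b rewrite dec-true (i <? σ at i) a | dec-true (suc i ≤? pos σ (suc i)) b = refl

  stepYZL-Lb : i < σ at i → pos σ (suc i) < suc i → stepYZL σ i ≡ Lb
  stepYZL-Lb a b rewrite dec-true (i <? σ at i) a | dec-false (suc i ≤? pos σ (suc i)) (<⇒≱ b) = refl

  stepYZL-Lᵣ : σ at i ≤ i → suc i ≤ pos σ (suc i) → stepYZL σ i ≡ Lᵣ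
  stepYZL-Lᵣ a b rewrite dec-false (i <? σ at i) (≤⇒≯ a) | dec-true (suc i ≤? pos σ (suc i)) b = refl

  stepYZL-D : σ at i ≤ i → pos σ (suc i) < suc i → stepYZL σ i ≡ D
  stepYZL-D a b rewrite dec-false (i <? σ at i) (≤⇒≯ a) | dec-false (suc i ≤? pos σ (suc i)) (<⇒≱ b) = refl

-- Agreement of the two histories at each index.

-- τ and π stand for Φ (hat σ) and Ψ σ, which are kept abstract because they
-- are expensive to normalise.
module _ {n} (σ : Permutation′ (suc n)) (τ : Permutation′ (2 + n)) (isΦ : IsΦ (hat σ) τ)
         (τ-first : τ at 1 ≡ 2 + n) (π : Permutation′ (suc n))
         (π-at : ∀ j → 1 ≤ j → j ≤ suc n → π at j ≡ τ at suc j)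
         {i} (1≤i : 1 ≤ i) (i≤n : i ≤ n) where
  private
    m = suc n
    x = suc i
    K = pos σ i
    open Biword (τ at_)

    i≤m : i ≤ m
    i≤m = m≤n⇒m≤1+n i≤n
    x≤m : x ≤ m
    x≤m = s≤s i≤n
    x≤1+m : x ≤ suc m
    x≤1+m = m≤n⇒m≤1+n x≤m
    1≤x : 1 ≤ x
    1≤x = s≤s z≤n

    π-i : π at i ≡ τ at x
    π-i = π-at i 1≤i i≤m

    suc-pos-π : suc (pos π x) ≡ pos τ x
    suc-pos-π = begin
      suc q                    ≡⟨ pos-at τ (s≤s z≤n) (s≤s (pos-≤ π x)) ⟨
      pos τ (τ at suc q)       ≡⟨ cong (pos τ) (π-at q (pos-≥1 π 1≤x x≤m) (pos-≤ π x)) ⟨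
      pos τ (π at q)           ≡⟨ cong (pos τ) (at-pos π 1≤x x≤m) ⟩
      pos τ x                  ∎
      where
      open ≡-Reasoning
      q = pos π x

    at-K : σ at K ≡ i
    at-K = at-pos σ 1≤i i≤m

    at≢i : ∀ {j} → K ≢ j → σ at j ≢ i
    at≢i K≢j e = K≢j (≡.trans (cong (pos σ) (≡.sym e)) (pos-unique σ _ (subst (1 ≤_) (≡.sym e) 1≤i)))

    right : σ at suc K < i ⊎ i < σ at suc K
    right with <-cmp (σ at suc K) i
    ... | tri< p _ _ = inj₁ p
    ... | tri≈ _ e _ = contradiction e (at≢i (<⇒≢ ≤-refl))
    ... | tri> _ _ p = inj₂ p

    left : σ at pred K < i ⊎ i < σ at pred K
    left with <-cmp (σ at pred K) i
    ... | tri< p _ _ = inj₁ p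
    ... | tri≈ _ e _ = contradiction e (at≢i (<⇒≢ (≤-reflexive (suc-pred-pos σ 1≤i i≤m)) ∘ ≡.sym))
    ... | tri> _ _ p = inj₂ p

    -- The letter i of σ is the letter x = i + 1 of `hat σ`, and π(i) = τ(x), so τ(x) < x reads π(i)
    -- ≤ i. In the same way the right neighbour of i decides the comparison of i with π(i), and the
    -- left neighbour that of x with π⁻¹(x).
    right-down : σ at suc K < i → π at i ≤ i
    right-down p = subst (_≤ i) (≡.sym π-i) (s≤s⁻¹ (Φ-descentTop isΦ 1≤x x≤1+m (hat-descentTop σ 1≤i i≤m p)))

    right-up : i < σ at suc K → i < π at i
    right-up p = subst (i <_) (≡.sym π-i) (Φ-nonDescentTop isΦ 1≤x x≤1+m (hat-nonDescentTop σ 1≤i i≤m p))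

    left-down : i < σ at pred K → x ≤ pos π x
    left-down p = s≤s⁻¹ (subst (x <_) (≡.sym suc-pos-π) (Φ-descentBottom isΦ 1≤x x≤1+m (hat-descentBottom σ 1≤i i≤m p)))

    left-up : σ at pred K < i → pos π x < x
    left-up p = subst (_≤ x) (≡.sym suc-pos-π) (Φ-nonDescentBottom isΦ 1≤x x≤1+m (hat-nonDescentBottom σ 1≤i i≤m p))

  -- Each step depends on two binary choices, which the left and right neighbours of i in σ
  -- determine for both paths.
  stepFV≡stepYZL : stepFV σ i ≡ stepYZL π i
  stepFV≡stepYZL = cases left right
    where
    cases : σ at pred K < i ⊎ i < σ at pred K → σ at suc K < i ⊎ i < σ at suc K → stepFV σ i ≡ stepYZL π i
    cases (inj₁ l) (inj₁ r) = ≡.trans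
      (stepFV-D σ i (subst (λ y → σ at pred K < y × σ at suc K < y) (≡.sym at-K) (l , r)))
      (≡.sym (stepYZL-D π i (right-down r) (left-up l)))
    cases (inj₁ l) (inj₂ r) = ≡.trans
      (stepFV-Lb σ i (subst (λ y → σ at pred K < y × y < σ at suc K) (≡.sym at-K) (l , r)))
      (≡.sym (stepYZL-Lb π i (right-up r) (left-up l)))
    cases (inj₂ l) (inj₁ r) = ≡.trans
      (stepFV-Lᵣ σ i (subst (λ y → y < σ at pred K × σ at suc K < y) (≡.sym at-K) (l , r)))
      (≡.sym (stepYZL-Lᵣ π i (right-down r) (left-down l)))
    cases (inj₂ l) (inj₂ r) = ≡.trans
      (stepFV-U σ i (subst (λ y → y < σ at pred K × y < σ at suc K) (≡.sym at-K) (l , r)))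
      (≡.sym (stepYZL-U π i (right-up r) (left-down l)))

  private
    nest-Σ : nest π i ≡ Σ< m (λ k → ι (isNesting? π i (suc k)))
    nest-Σ = count-Σ (isNesting? π i) m

    -- Compares the letters 2, …, m+1 of τ with those of π; the letter τ(1)
    -- is accounted for separately.
    split-first : ∀ {P : ℕ → Set} (P? : Decidable P) →
                  (∀ k → k < m → ι (P? (2 + k)) ≡ ι (isNesting? π i (suc k))) →
                  count P? [1… suc m ] ≡ ι (P? 1) + nest π i
    split-first P? h = begin
      count P? [1… suc m ]                             ≡⟨ count-Σ P? (suc m) ⟩
      Σ< (suc m) (λ k → ι (P? (suc k)))                ≡⟨ Σ-head m _ ⟩
      ι (P? 1) + Σ< m (λ k → ι (P? (2 + k)))           ≡⟨ cong (ι (P? 1) +_) (Σ-cong m h) ⟩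
      ι (P? 1) + Σ< m (λ k → ι (isNesting? π i (suc k))) ≡⟨ cong (ι (P? 1) +_) nest-Σ ⟨
      ι (P? 1) + nest π i                              ∎
      where open ≡-Reasoning

    π-k : ∀ {k} → k < m → π at suc k ≡ τ at (2 + k)
    π-k k<m = π-at _ (s≤s z≤n) k<m

    -- The largest letter n + 2 is τ(1), and x ≥ 2 is another position.
    τx<τ1 : τ at x < τ at 1
    τx<τ1 = subst (τ at x <_) (≡.sym τ-first) (≤∧≢⇒< (at-≤ τ x) λ e →
      <⇒≢ (s≤s 1≤i) (≡.sym (≡.trans (≡.sym (pos-at τ 1≤x x≤1+m))
        (≡.trans (cong (pos τ) (≡.trans e (≡.sym τ-first))) (pos-at τ ≤-refl (s≤s z≤n))))))

  -- Two corrections cancel. Passing from 2-13 in σ to 2-31 in `hat σ` adds one exactly when i is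
  -- followed by a larger letter; in that case the first letter of τ, which π lacks, also forms one
  -- additional pair with x, and otherwise none.
  pat2-13≡nest : pat2-13 σ i ≡ nest π i
  pat2-13≡nest with right
  ... | inj₁ r = begin
    pat2-13 σ i                             ≡⟨ +-identityʳ _ ⟨
    pat2-13 σ i + 0                         ≡⟨ cong (pat2-13 σ i +_) (ι-no (i <? σ at suc K) (<-asym r)) ⟨
    pat2-13 σ i + ι (i <? σ at suc K)       ≡⟨ pat2-31-hat σ 1≤i i≤m ⟨
    pat2-31 (hat σ) x                       ≡⟨ pat2-31-descentTop isΦ 1≤x x≤1+m (hat-descentTop σ 1≤i i≤m r) ⟩
    count (invBelow? x) [1… suc m ]         ≡⟨ split-first (invBelow? x) (λ k k<m → ι-cong (invBelow? x (2 + k)) (isNesting? π i (suc k))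
                                                 (λ { (p , q) → inj₂ (≡.subst₂ _<_ (≡.sym (π-k k<m)) (≡.sym π-i) p , right-down r , s≤s⁻¹ q) })
                                                 (λ { (inj₁ (_ , p , _)) → contradiction (right-down r) (<⇒≱ p)
                                                    ; (inj₂ (p , _ , q)) → ≡.subst₂ _<_ (π-k k<m) π-i p , s≤s q })) ⟩
    ι (invBelow? x 1) + nest π i            ≡⟨ cong (_+ nest π i) (ι-no (invBelow? x 1) λ { (_ , p) → <-asym p (s≤s 1≤i) }) ⟩
    nest π i                                ∎
    where open ≡-Reasoning
  ... | inj₂ r = suc-injective (begin
    suc (pat2-13 σ i)                       ≡⟨ +-comm (pat2-13 σ i) 1 ⟨
    pat2-13 σ i + 1                         ≡⟨ cong (pat2-13 σ i +_) (ι-yes (i <? σ at suc K) r) ⟨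
    pat2-13 σ i + ι (i <? σ at suc K)       ≡⟨ pat2-31-hat σ 1≤i i≤m ⟨
    pat2-31 (hat σ) x                       ≡⟨ pat2-31-nonDescentTop isΦ 1≤x x≤1+m (hat-nonDescentTop σ 1≤i i≤m r) ⟩
    count (invAbove? x) [1… suc m ]         ≡⟨ split-first (invAbove? x) (λ k k<m → ι-cong (invAbove? x (2 + k)) (isNesting? π i (suc k))
                                                 (λ { (p , q) → inj₁ (s≤s⁻¹ q , right-up r , ≡.subst₂ _<_ (≡.sym π-i) (≡.sym (π-k k<m)) p) })
                                                 (λ { (inj₁ (q , _ , p)) → ≡.subst₂ _<_ π-i (π-k k<m) p , s≤s q
                                                    ; (inj₂ (_ , p , _)) → contradiction (right-up r) (≤⇒≯ p) })) ⟩
    ι (invAbove? x 1) + nest π i            ≡⟨ cong (_+ nest π i) (ι-yes (invAbove? x 1) (τx<τ1 , s≤s 1≤i)) ⟩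
    suc (nest π i)                          ∎)
    where open ≡-Reasoning

-- The two remaining fields are irrelevant proofs.
LaguerreHistory-≡ : ∀ {n} {a b : LaguerreHistory n} → LaguerreHistory.s a ≡ LaguerreHistory.s b →
                    LaguerreHistory.p a ≡ LaguerreHistory.p b → a ≡ b
LaguerreHistory-≡ {a = record {}} {record {}} refl refl = refl

theorem2p7 : ∀ (n : ℕ) (σ : Permutation′ (suc n)) → ψFV σ ≡ ψYZL (Ψ σ)
theorem2p7 n σ = LaguerreHistory-≡
  (tabulate-cong λ i → stepFV≡stepYZL σ (Φ (hat σ)) (Φ-isΦ (hat σ)) (Φ-hat-first σ) (Ψ σ) (Ψ-at σ) (s≤s z≤n) (toℕ<n i))
  (tabulate-cong λ i → pat2-13≡nest σ (Φ (hat σ)) (Φ-isΦ (hat σ)) (Φ-hat-first σ) (Ψ σ) (Ψ-at σ) (s≤s z≤n) (toℕ<n i))
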